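{- Let $d \geq 3$, let $q$ be a prime power, and let $r$ be either $r = 2\frac{q^d-1}{q-1}$ or $r = \binom{d}{1}_q + \binom{d}{2}_q + \cdots + \binom{d}{d-1}_q$. Then for every $m \in \mathbb{N}$ there exist $m$ finite $r$-regular graphs which are pairwise isospectral and pairwise non-isomorphic.
   Context: Two finite graphs are isospectral if their adjacency matrices have the same multiset of eigenvalues. $\binom{d}{i}_q$ denotes the number of $i$-dimensional $\mathbb{F}_q$-subspaces of $\mathbb{F}_q^d$. -}

module Defs where

open import Data.Bool using (Bool; true; false; if_then_else_)
open import Data.Nat as ℕ using (ℕ; zero; suc)
open import Data.Nat.Primality using (Prime)
open import Data.Integer as ℤ using (ℤ)
open import Data.Fin using (Fin; zero; suc; punchIn; _≟_)
open import Data.List using (List; []; _∷_; map; foldr; allFin; upTo)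
open import Data.Nat.ListAction using (sum)
open import Data.Product using (Σ; ∃; _×_)
open import Function.Bundles using (_↔_; Inverse)
open import Relation.Binary.PropositionalEquality using (_≡_)
open import Relation.Nullary using (does)

record Graph (n : ℕ) : Set where
  field
    adj    : Fin n → Fin n → Bool
    sym    : ∀ i j → adj i j ≡ adj j i
    irrefl : ∀ i → adj i i ≡ false
open Graph public

degree : ∀ {n} → Graph n → Fin n → ℕ
degree {n} G i = sum (map (λ j → if adj G i j then 1 else 0) (allFin n))

Regular : ℕ → ∀ {n} → Graph n → Set
Regular r G = ∀ i → degree G i ≡ r

Isomorphic : ∀ {n m} → Graph n → Graph m → Set
Isomorphic {n} {m} G H =
  Σ (Fin n ↔ Fin m) λ e → ∀ i j → adj G i j ≡ adj H (Inverse.to e i) (Inverse.to e j)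

-- Polynomials over ℤ as coefficient lists (lowest degree first)

Poly : Set
Poly = List ℤ

infixl 6 _⊕_
infixl 7 _⊗_

_⊕_ : Poly → Poly → Poly
[] ⊕ q = q
(a ∷ p) ⊕ [] = a ∷ p
(a ∷ p) ⊕ (b ∷ q) = (a ℤ.+ b) ∷ (p ⊕ q)

_⊗_ : Poly → Poly → Poly
[] ⊗ q = []
(a ∷ p) ⊗ q = map (a ℤ.*_) q ⊕ (ℤ.0ℤ ∷ (p ⊗ q))

coeff : Poly → ℕ → ℤ
coeff [] k = ℤ.0ℤ
coeff (a ∷ p) zero = a
coeff (a ∷ p) (suc k) = coeff p k

sumP : ∀ {n} → (Fin n → Poly) → Poly
sumP {n} f = foldr _⊕_ [] (map f (allFin n))

sign : ℕ → ℤ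
sign zero = ℤ.1ℤ
sign (suc k) = ℤ.- sign k

det : ∀ n → (Fin n → Fin n → Poly) → Poly
det zero M = ℤ.1ℤ ∷ []
det (suc n) M =
  sumP (λ j → (sign (Data.Fin.toℕ j) ∷ []) ⊗ (M zero j ⊗ det n (λ a b → M (suc a) (punchIn j b))))

adjℤ : ∀ {n} → Graph n → Fin n → Fin n → ℤ
adjℤ G i j = if adj G i j then ℤ.1ℤ else ℤ.0ℤ

charPoly : ∀ {n} → Graph n → Poly
charPoly {n} G =
  det n (λ i j → (if does (i ≟ j) then ℤ.0ℤ ∷ ℤ.1ℤ ∷ [] else []) ⊕ (ℤ.- adjℤ G i j ∷ []))

-- isospectral: adjacency matrices have the same multiset of eigenvalues,
-- i.e. the same characteristic polynomial
Isospectral : ∀ {n m} → Graph n → Graph m → Set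
Isospectral G H = ∀ k → coeff (charPoly G) k ≡ coeff (charPoly H) k

PrimePower : ℕ → Set
PrimePower q = ∃ λ p → ∃ λ k → Prime p × q ≡ p ℕ.^ suc k

-- Gaussian binomial [d choose i]_q (number of i-dim subspaces of F_q^d),
-- via the q-Pascal recurrence
gauss : ℕ → ℕ → ℕ → ℕ
gauss q d zero = 1
gauss q zero (suc i) = 0
gauss q (suc d) (suc i) = gauss q d i ℕ.+ q ℕ.^ suc i ℕ.* gauss q d (suc i)

gaussMiddleSum : ℕ → ℕ → ℕ
gaussMiddleSum q d = sum (map (λ i → gauss q d (suc i)) (upTo (d ℕ.∸ 1)))

{-# OPTIONS --safe #-}

-- The graphs may be disconnected, and only r ≥ 3 matters.  Let X be the lift of the complete graph K
-- on r + 1 vertices along a voltage assignment in the Klein four-group V = {1, s, t, st}.  The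
-- permutation modules V ⊔ 1 ⊔ 1 and V/⟨s⟩ ⊔ V/⟨t⟩ ⊔ V/⟨st⟩ are isomorphic over ℚ, so X ⊔ K ⊔ K is
-- isospectral to X/⟨s⟩ ⊔ X/⟨t⟩ ⊔ X/⟨st⟩.  Only the former has components K, that is vertices whose
-- neighbourhood is a clique, so the unions of i copies of the former and m - i copies of the latter
-- are distinguished by the number of such vertices.
module Submission where

open import Defs hiding (sym)
open import Algebra.Bundles using (CommutativeMonoid)
open import Data.Bool as Bool using (Bool; true; false; _∧_; not; if_then_else_)
open import Data.Fin using
  (Fin; zero; suc; toℕ; punchIn; pinch; _≟_; _↑ˡ_; _↑ʳ_; combine; remQuot; quotient; remainder)
open import Data.Fin.Patterns using (0F; 1F; 2F; 3F; 4F; 5F)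
open import Data.Fin.Properties using
  (remQuot-combine; combine-remQuot; combine-injectiveˡ; combine-surjective; all?; toℕ<n; toℕ-injective)
open import Data.Integer using (ℤ; _+_; _*_; -_; _^_; 0ℤ; 1ℤ; -1ℤ; +_; ∣_∣; NonZero)
import Data.Integer.Properties as ℤ
open import Data.Integer.Tactic.RingSolver using (solve-∀)
open import Data.List as List using ([]; _∷_)
open import Data.Nat as ℕ using (ℕ; zero; suc; _<ᵇ_)
open import Data.Nat.Primality using (prime⇒nonTrivial)
import Data.Nat.Properties as ℕ
open import Data.Product using (Σ; _×_; _,_; proj₁; proj₂)
open import Data.Sum using (_⊎_; inj₁; inj₂)
open import Data.Unit using (⊤; tt)
open import Data.Vec using (lookup; []; _∷_)
open import Data.Vec.Functional using (Vector; head; tail; insertAt; removeAt) renaming (_∷_ to _◂_)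
open import Function using (_∘_; id; mk⇔; module Inverse)
open import Level using (0ℓ)
open import Relation.Binary.PropositionalEquality hiding (resp)
open import Relation.Nullary using (Dec; does; yes; no; ¬_; ¬?; contradiction)
open import Relation.Nullary.Decidable using (does-⇔; dec-true; dec-false; from-yes; _→-dec_)

-- `Isospectral` compares coefficient lists produced by Laplace expansion, so an isomorphism of
-- permutation modules helps only once determinants are known to be multiplicative. Determinants
-- over ℤ suffice for this: a polynomial is determined by its values at positive integers, and
-- evaluation turns `charPoly` into an integer determinant. The isomorphism of modules lives over ℚ;
-- over ℤ it becomes a pair `P`, `Q` with `P ⊡ Q` twice the identity, and a power of 2 is cancelled
-- at the end.
--
-- All members of the family are lifts of one base, `m` copies of K, and differ only in which of two
-- six-point V-sets sits over each copy. A single block-diagonal intertwiner, with one block per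
-- base vertex, therefore handles all mixtures at once.
--
-- The bound on r leaves room in K for two disjoint edges, one carrying s and the other t. In a
-- triangle the closed walks have net voltages in a cyclic group only, which is never all of V.

module SumCombine (M : CommutativeMonoid 0ℓ 0ℓ) where
  open CommutativeMonoid M renaming (_∙_ to _⊞_; refl to ≈-refl; sym to ≈-sym; trans to ≈-trans)
  open import Algebra.Properties.CommutativeMonoid.Sum M renaming (sum to ∑)

  sum-↑ : ∀ m n (f : Fin (m ℕ.+ n) → Carrier) → ∑ f ≈ (∑ λ i → f (i ↑ˡ n)) ⊞ (∑ λ j → f (m ↑ʳ j))
  sum-↑ zero    n f = ≈-sym (identityˡ _)
  sum-↑ (suc m) n f = ≈-trans (∙-congˡ (sum-↑ m n (f ∘ suc))) (≈-sym (assoc _ _ _))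

  sum-combine : ∀ m n (f : Fin (m ℕ.* n) → Carrier) → ∑ f ≈ ∑ λ i → ∑ λ j → f (combine {m} i j)
  sum-combine zero    n f = ≈-refl
  sum-combine (suc m) n f = ≈-trans (sum-↑ n (m ℕ.* n) f) (∙-congˡ (sum-combine m n λ i → f (n ↑ʳ i)))

open SumCombine ℤ.+-0-commutativeMonoid using (sum-combine)
open SumCombine ℕ.+-0-commutativeMonoid using () renaming (sum-combine to sumℕ-combine)
open import Algebra.Properties.AbelianGroup ℤ.+-0-abelianGroup using (∙-cancelˡ)
open import Algebra.Properties.CommutativeMonoid.Sum ℕ.+-0-commutativeMonoid
  using () renaming (sum to sumℕ; sum-cong-≗ to sumℕ-cong; sum-permute to sumℕ-permute)
open import Algebra.Properties.Semiring.Sum ℤ.+-*-semiring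
  using (sum; sum-cong-≗; ∑-distrib-+; sum-replicate-zero; *-distribˡ-sum; *-distribʳ-sum)
open ≡-Reasoning

-- Determinants

Row : ℕ → Set
Row n = Vector ℤ n

Matrix : ℕ → ℕ → Set
Matrix n m = Vector (Row m) n

infix 4 _≈_
_≈_ : ∀ {n m} → Matrix n m → Matrix n m → Set
M ≈ N = ∀ i → M i ≗ N i

◂-cong : ∀ {n m} {u v : Row m} {M N : Matrix n m} → u ≗ v → M ≈ N → (u ◂ M) ≈ (v ◂ N)
◂-cong p q zero    = p
◂-cong p q (suc i) = q i

◂-tail : ∀ {n m} (M : Matrix (suc n) m) → M ≈ (head M ◂ tail M)
◂-tail M zero    k = refl
◂-tail M (suc i) k = refl

δ : ∀ {n} → Fin n → Fin n → ℤ
δ i j = if does (i ≟ j) then 1ℤ else 0ℤ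

δ-sym : ∀ {n} (i j : Fin n) → δ i j ≡ δ j i
δ-sym zero    zero    = refl
δ-sym zero    (suc j) = refl
δ-sym (suc i) zero    = refl
δ-sym (suc i) (suc j) = δ-sym i j

sum-zero : ∀ {n} {f : Fin n → ℤ} → (∀ i → f i ≡ 0ℤ) → sum f ≡ 0ℤ
sum-zero {n} p = trans (sum-cong-≗ p) (sum-replicate-zero n)

sum-δˡ : ∀ {n} (i : Fin n) (f : Fin n → ℤ) → sum (λ j → δ i j * f j) ≡ f i
sum-δˡ zero f = begin
  1ℤ * f zero + sum (λ j → 0ℤ * f (suc j))
    ≡⟨ cong₂ _+_ (ℤ.*-identityˡ (f zero)) (sum-zero λ j → ℤ.*-zeroˡ (f (suc j))) ⟩
  f zero + 0ℤ ≡⟨ ℤ.+-identityʳ _ ⟩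
  f zero      ∎
sum-δˡ (suc i) f = begin
  0ℤ * f zero + sum (λ j → δ i j * f (suc j)) ≡⟨ cong₂ _+_ (ℤ.*-zeroˡ (f zero)) (sum-δˡ i (f ∘ suc)) ⟩
  0ℤ + f (suc i)                              ≡⟨ ℤ.+-identityˡ _ ⟩
  f (suc i)                                   ∎

sum-δʳ : ∀ {n} (i : Fin n) (f : Fin n → ℤ) → sum (λ j → f j * δ j i) ≡ f i
sum-δʳ i f = trans (sum-cong-≗ λ j → trans (ℤ.*-comm (f j) (δ j i)) (cong (_* f j) (δ-sym j i))) (sum-δˡ i f)

sum-linear : ∀ {n} a b (f g : Fin n → ℤ) → sum (λ j → a * f j + b * g j) ≡ a * sum f + b * sum g
sum-linear a b f g =
  trans (∑-distrib-+ (λ j → a * f j) (λ j → b * g j)) (sym (cong₂ _+_ (*-distribˡ-sum a f) (*-distribˡ-sum b g)))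

-- Alternating multilinear forms in the rows of a matrix.

-- Rows and matrices are functions, and pointwise equality does not yield propositional equality of
-- functions; compatibility with `_≈_` is therefore carried as a hypothesis.
Respects : ∀ {n m} → (Matrix n m → ℤ) → Set
Respects D = ∀ {M N} → M ≈ N → D M ≡ D N

Linear : ∀ {m} → (Row m → ℤ) → Set
Linear φ = ∀ a b u v → φ (λ k → a * u k + b * v k) ≡ a * φ u + b * φ v

Alternating : ∀ {m} n → (Matrix n m → ℤ) → Set
Alternating zero          D = ⊤
Alternating (suc zero)    D = ⊤
Alternating (suc (suc n)) D = ∀ v M → D (v ◂ v ◂ M) ≡ 0ℤ

-- The alternating condition is only imposed on adjacent rows.
AltForm : ∀ {m} n → (Matrix n m → ℤ) → Set
AltForm zero    D = ⊤
AltForm (suc n) D =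
  (∀ M → Linear λ u → D (u ◂ M)) × Alternating (suc n) D × (∀ v → AltForm n λ M → D (v ◂ M))

◂-respects : ∀ {n m} {D : Matrix (suc n) m → ℤ} → Respects D → ∀ v → Respects λ M → D (v ◂ M)
◂-respects resp v M≈N = resp (◂-cong (λ _ → refl) M≈N)

AltForm-cong : ∀ {m} n {D E : Matrix n m → ℤ} → (∀ M → D M ≡ E M) → AltForm n D → AltForm n E
AltForm-cong zero    p _ = tt
AltForm-cong (suc n) {D} {E} p (lin , alt , rest) =
  (λ M a b u v → trans (sym (p _)) (trans (lin M a b u v) (cong₂ (λ x y → a * x + b * y) (p _) (p _)))) ,
  alternating n p alt ,
  λ v → AltForm-cong n (λ M → p _) (rest v)
  where
  alternating : ∀ n {D E : Matrix (suc n) _ → ℤ} → (∀ M → D M ≡ E M) →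
                Alternating (suc n) D → Alternating (suc n) E
  alternating zero    p alt     = tt
  alternating (suc n) p alt v M = trans (sym (p _)) (alt v M)

AltForm-sum : ∀ {m l} n (c : Fin l → ℤ) {D : Fin l → Matrix n m → ℤ} →
              (∀ j → AltForm n (D j)) → AltForm n λ M → sum λ j → c j * D j M
AltForm-sum zero    c f = tt
AltForm-sum (suc n) c {D} f =
  (λ M a b u v → trans
    (sum-cong-≗ λ j → trans (cong (c j *_) (proj₁ (f j) M a b u v)) (distrib (c j) a b (D j (u ◂ M)) (D j (v ◂ M))))
    (sum-linear a b (λ j → c j * D j (u ◂ M)) (λ j → c j * D j (v ◂ M)))) ,
  alternating n (λ j → proj₁ (proj₂ (f j))) ,
  λ v → AltForm-sum n c λ j → proj₂ (proj₂ (f j)) v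
  where
  distrib : ∀ c a b x y → c * (a * x + b * y) ≡ a * (c * x) + b * (c * y)
  distrib = solve-∀
  alternating : ∀ n {D : Fin _ → Matrix (suc n) _ → ℤ} → (∀ j → Alternating (suc n) (D j)) →
                Alternating (suc n) λ M → sum λ j → c j * D j M
  alternating zero    alt     = tt
  alternating (suc n) alt v M = sum-zero λ j → trans (cong (c j *_) (alt j v M)) (ℤ.*-zeroʳ (c j))

record LinearMap (m l : ℕ) : Set where
  field
    map    : Row m → Row l
    resp   : ∀ {u v} → u ≗ v → map u ≗ map v
    linear : ∀ a b u v → map (λ k → a * u k + b * v k) ≗ (λ k → a * map u k + b * map v k)

-- A linear map applied to every row keeps linearity in each row and keeps equal rows equal. The
-- instances are deletion of a column, insertion of a zero column, and right multiplication by a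
-- matrix.
AltForm-map : ∀ {m l} n (L : LinearMap m l) {D : Matrix n l → ℤ} → Respects D →
              AltForm n D → AltForm n λ M → D (LinearMap.map L ∘ M)
AltForm-map zero    L R f = tt
AltForm-map (suc n) L {D} R (lin , alt , rest) =
  (λ M a b u v → trans (map-◂ _ M)
    (trans (R (◂-cong (linear a b u v) λ _ _ → refl))
    (trans (lin (map ∘ M) a b (map u) (map v))
    (sym (cong₂ (λ x y → a * x + b * y) (map-◂ u M) (map-◂ v M)))))) ,
  alternating n R alt ,
  λ v → AltForm-cong n (λ M → sym (map-◂ v M)) (AltForm-map n L (◂-respects R (map v)) (rest (map v)))
  where
  open LinearMap L
  ∘-◂ : ∀ {n} v (M : Matrix n _) → (map ∘ (v ◂ M)) ≈ (map v ◂ map ∘ M)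
  ∘-◂ v M zero    _ = refl
  ∘-◂ v M (suc i) _ = refl
  map-◂ : ∀ v M → D (map ∘ (v ◂ M)) ≡ D (map v ◂ map ∘ M)
  map-◂ v M = R (∘-◂ v M)
  alternating : ∀ n {D : Matrix (suc n) _ → ℤ} → Respects D → Alternating (suc n) D →
                Alternating (suc n) λ M → D (map ∘ M)
  alternating zero    R alt     = tt
  alternating (suc n) R alt v M =
    trans (R λ { zero _ → refl ; (suc zero) _ → refl ; (suc (suc i)) _ → refl }) (alt (map v) (map ∘ M))

-- Polarisation: `D` vanishes when `u + v` is repeated, and so do two of the four terms of the
-- expansion. The sum `w` is spelled with coefficients `1ℤ` to fit `Linear`.
swap-neg : ∀ {n m} {D : Matrix (suc (suc n)) m → ℤ} → Respects D → AltForm (suc (suc n)) D →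
           ∀ u v M → D (u ◂ v ◂ M) ≡ - D (v ◂ u ◂ M)
swap-neg {D = D} R (lin , alt , rest) u v M = begin
  D (u ◂ v ◂ M)
    ≡⟨ rearrange (D (u ◂ u ◂ M)) (D (u ◂ v ◂ M)) (D (v ◂ u ◂ M)) (D (v ◂ v ◂ M)) ⟩
  (1ℤ * (1ℤ * D (u ◂ u ◂ M) + 1ℤ * D (u ◂ v ◂ M)) + 1ℤ * (1ℤ * D (v ◂ u ◂ M) + 1ℤ * D (v ◂ v ◂ M)))
    + - D (u ◂ u ◂ M) + - D (v ◂ v ◂ M) + - D (v ◂ u ◂ M)
    ≡⟨ cong (λ x → x + - D (u ◂ u ◂ M) + - D (v ◂ v ◂ M) + - D (v ◂ u ◂ M))
         (sym (trans (lin (w ◂ M) 1ℤ 1ℤ u v)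
               (cong₂ (λ x y → 1ℤ * x + 1ℤ * y) (proj₁ (rest u) M 1ℤ 1ℤ u v) (proj₁ (rest v) M 1ℤ 1ℤ u v)))) ⟩
  D (w ◂ w ◂ M) + - D (u ◂ u ◂ M) + - D (v ◂ v ◂ M) + - D (v ◂ u ◂ M)
    ≡⟨ cong (_+ - D (v ◂ u ◂ M)) (cong₂ _+_ (cong₂ _+_ (alt w M) (cong -_ (alt u M))) (cong -_ (alt v M))) ⟩
  0ℤ + - D (v ◂ u ◂ M) ≡⟨ ℤ.+-identityˡ _ ⟩
  - D (v ◂ u ◂ M) ∎
  where
  w : Row _
  w k = 1ℤ * u k + 1ℤ * v k
  rearrange : ∀ a b c d → b ≡ (1ℤ * (1ℤ * a + 1ℤ * b) + 1ℤ * (1ℤ * c + 1ℤ * d)) + - a + - d + - c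
  rearrange = solve-∀

-- Alternation on adjacent rows is enough: a swap moves `v` one row closer to its double, and the
-- row that went to the front is then held fixed.
repeated-row : ∀ {n m} {D : Matrix (suc n) m → ℤ} → Respects D → AltForm (suc n) D →
               ∀ v M i → M i ≗ v → D (v ◂ M) ≡ 0ℤ
repeated-row {suc n} {D = D} R (lin , alt , rest) v M zero Mᵢ≗v =
  trans (R λ { zero _ → refl ; (suc zero) k → Mᵢ≗v k ; (suc (suc i)) k → refl }) (alt v (tail M))
repeated-row {suc n} {D = D} R f@(lin , alt , rest) v M (suc i) Mᵢ≗v = begin
  D (v ◂ M)                   ≡⟨ R (◂-cong (λ _ → refl) (◂-tail M)) ⟩
  D (v ◂ head M ◂ tail M)     ≡⟨ swap-neg R f v (head M) (tail M) ⟩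
  - D (head M ◂ v ◂ tail M)   ≡⟨ cong -_ (repeated-row (◂-respects R (head M)) (rest (head M)) v (tail M) i Mᵢ≗v) ⟩
  0ℤ                          ∎

-- Row `i` passes the `i` rows above it by adjacent swaps, one sign for each.
row-to-front : ∀ {n m} {D : Matrix (suc n) m → ℤ} → Respects D → AltForm (suc n) D →
               ∀ M i → D (M i ◂ removeAt M i) ≡ sign (toℕ i) * D M
row-to-front R f M zero = trans (sym (R (◂-tail M))) (sym (ℤ.*-identityˡ _))
row-to-front {suc n} {D = D} R f@(lin , alt , rest) M (suc i) = begin
  D (M (suc i) ◂ removeAt M (suc i))
    ≡⟨ R (◂-cong (λ _ → refl) (◂-tail (removeAt M (suc i)))) ⟩
  D (M (suc i) ◂ head M ◂ removeAt (tail M) i)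
    ≡⟨ swap-neg R f _ _ _ ⟩
  - D (head M ◂ M (suc i) ◂ removeAt (tail M) i)
    ≡⟨ cong -_ (row-to-front (◂-respects R (head M)) (rest (head M)) (tail M) i) ⟩
  - (sign (toℕ i) * D (head M ◂ tail M))
    ≡⟨ ℤ.neg-distribˡ-* (sign (toℕ i)) _ ⟩
  - sign (toℕ i) * D (head M ◂ tail M)
    ≡⟨ cong (- sign (toℕ i) *_) (sym (R (◂-tail M))) ⟩
  - sign (toℕ i) * D M ∎

-- D vanishes as soon as v occurs as a row, so multiples of v may be added to every row.
add-multiples : ∀ {n m} {D : Matrix n m → ℤ} → Respects D → AltForm n D → ∀ v →
                (∀ M i → M i ≗ v → D M ≡ 0ℤ) →
                ∀ (c : Fin n → ℤ) M → D (λ i k → 1ℤ * M i k + c i * v k) ≡ D M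
add-multiples {zero}  R f v vanish c M = R λ ()
add-multiples {suc n} {D = D} R (lin , alt , rest) v vanish c M = begin
  D (λ i k → 1ℤ * M i k + c i * v k)
    ≡⟨ R (◂-tail (λ i k → 1ℤ * M i k + c i * v k)) ⟩
  D (u ◂ λ i k → 1ℤ * M (suc i) k + c (suc i) * v k)
    ≡⟨ add-multiples (◂-respects R u) (rest u) v (λ N i p → vanish (u ◂ N) (suc i) p) (c ∘ suc) (tail M) ⟩
  D (u ◂ tail M)
    ≡⟨ lin (tail M) 1ℤ (c zero) (head M) v ⟩
  1ℤ * D (head M ◂ tail M) + c zero * D (v ◂ tail M)
    ≡⟨ cong₂ (λ x y → 1ℤ * x + c zero * y) (sym (R (◂-tail M))) (vanish (v ◂ tail M) zero λ _ → refl) ⟩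
  1ℤ * D M + c zero * 0ℤ
    ≡⟨ simplify (D M) (c zero) ⟩
  D M ∎
  where
  u : Row _
  u k = 1ℤ * M zero k + c zero * v k
  simplify : ∀ x c → 1ℤ * x + c * 0ℤ ≡ x
  simplify = solve-∀

expand-basis : ∀ {m} (φ : Row m → ℤ) → (∀ {u v} → u ≗ v → φ u ≡ φ v) → Linear φ →
               ∀ v → φ v ≡ sum λ j → v j * φ (δ j)
expand-basis {m} φ resp lin v = trans (resp λ k → sym (sum-δʳ k v)) (push m (λ j → j))
  where
  φ0 : φ (λ _ → 0ℤ) ≡ 0ℤ
  φ0 = trans (lin 0ℤ 0ℤ (λ _ → 0ℤ) (λ _ → 0ℤ)) (zeros (φ λ _ → 0ℤ))
    where
    zeros : ∀ x → 0ℤ * x + 0ℤ * x ≡ 0ℤ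
    zeros = solve-∀
  -- The summation range is separated from the row length `m`, so that the induction can peel off
  -- basis vectors while the rows keep their length.
  push : ∀ l (ι : Fin l → Fin m) →
         φ (λ k → sum λ j → v (ι j) * δ (ι j) k) ≡ sum λ j → v (ι j) * φ (δ (ι j))
  push zero    ι = φ0
  push (suc l) ι = begin
    φ (λ k → v (ι zero) * δ (ι zero) k + sum λ j → v (ι (suc j)) * δ (ι (suc j)) k)
      ≡⟨ resp (λ k → cong (λ x → (v (ι zero) * δ (ι zero) k) + x)
             (sym (ℤ.*-identityˡ (sum λ j → v (ι (suc j)) * δ (ι (suc j)) k)))) ⟩
    φ (λ k → v (ι zero) * δ (ι zero) k + 1ℤ * sum λ j → v (ι (suc j)) * δ (ι (suc j)) k)
      ≡⟨ lin (v (ι zero)) 1ℤ (δ (ι zero)) _ ⟩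
    v (ι zero) * φ (δ (ι zero)) + 1ℤ * φ (λ k → sum λ j → v (ι (suc j)) * δ (ι (suc j)) k)
      ≡⟨ cong (λ x → (v (ι zero) * φ (δ (ι zero))) + x)
           (trans (ℤ.*-identityˡ (φ λ k → sum λ j → v (ι (suc j)) * δ (ι (suc j)) k)) (push l (ι ∘ suc))) ⟩
    _ ∎

-- The Laplace expansion is an alternating form.

minor : ∀ {n} → Matrix (suc n) (suc n) → Fin (suc n) → Matrix n n
minor M j a b = M (suc a) (punchIn j b)

detℤ : ∀ n → Matrix n n → ℤ
detℤ zero    M = 1ℤ
detℤ (suc n) M = sum λ j → sign (toℕ j) * (M zero j * detℤ n (minor M j))

detℤ-cong : ∀ n → Respects (detℤ n)
detℤ-cong zero    M≈N = refl
detℤ-cong (suc n) M≈N = sum-cong-≗ λ j →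
  cong (sign (toℕ j) *_) (cong₂ _*_ (M≈N zero j) (detℤ-cong n λ a b → M≈N (suc a) (punchIn j b)))

-- Deleting column `j` and then `punchIn j k` leaves the same columns as deleting them in the
-- opposite order; `pinch k j` is the position of column `j` once `punchIn j k` is gone.
punchIn-punchIn : ∀ {n} (j : Fin (suc (suc n))) (k : Fin (suc n)) b →
                  punchIn (punchIn j k) (punchIn (pinch k j) b) ≡ punchIn j (punchIn k b)
punchIn-punchIn zero    k       b       = refl
punchIn-punchIn (suc j) zero    b       = refl
punchIn-punchIn (suc j) (suc k) zero    = refl
punchIn-punchIn (suc j) (suc k) (suc b) = cong suc (punchIn-punchIn j k b)

punchIn-pinch : ∀ {n} (j : Fin (suc n)) (k : Fin n) → punchIn (punchIn j k) (pinch k j) ≡ j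
punchIn-pinch {suc n} zero    k       = refl
punchIn-pinch {suc n} (suc j) zero    = refl
punchIn-pinch {suc n} (suc j) (suc k) = cong suc (punchIn-pinch j k)

-- Of the two columns, the left one keeps its position when deleted second, while the right one
-- moves by one when deleted second; so the two orders have opposite parity.
sign-punchIn : ∀ {n} (j : Fin (suc n)) (k : Fin n) →
               sign (toℕ (punchIn j k)) * sign (toℕ (pinch k j)) ≡ - (sign (toℕ j) * sign (toℕ k))
sign-punchIn {suc n} zero    k       = lemma (sign (toℕ k))
  where
  lemma : ∀ x → - x * 1ℤ ≡ - (1ℤ * x)
  lemma = solve-∀
sign-punchIn {suc n} (suc j) zero    = lemma (sign (toℕ j))
  where
  lemma : ∀ x → 1ℤ * x ≡ - (- x * 1ℤ)
  lemma = solve-∀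
sign-punchIn {suc n} (suc j) (suc k) =
  trans (negs (sign (toℕ (punchIn j k))) (sign (toℕ (pinch k j))))
    (trans (sign-punchIn j k) (cong -_ (sym (negs (sign (toℕ j)) (sign (toℕ k))))))
  where
  negs : ∀ x y → - x * - y ≡ x * y
  negs = solve-∀

-- (j , k) ↦ (punchIn j k , pinch k j) is an involution exchanging the two members of the
-- ordered pair of distinct indices j, punchIn j k.
sum-antisymmetric : ∀ n (g : Fin (suc n) → Fin n → ℤ) →
                    (∀ j k → g (punchIn j k) (pinch k j) ≡ - g j k) →
                    sum (λ j → sum (g j)) ≡ 0ℤ
sum-antisymmetric zero    g anti = refl
sum-antisymmetric (suc n) g anti = begin
  sum (g zero) + sum (λ j → g (suc j) zero + sum (g (suc j) ∘ suc))
    ≡⟨ cong (λ x → sum (g zero) + x) (∑-distrib-+ (λ j → g (suc j) zero) (λ j → sum (g (suc j) ∘ suc))) ⟩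
  sum (g zero) + (sum (λ j → g (suc j) zero) + sum (λ j → sum (g (suc j) ∘ suc)))
    ≡⟨ sym (ℤ.+-assoc (sum (g zero)) _ _) ⟩
  sum (g zero) + sum (λ j → g (suc j) zero) + sum (λ j → sum (g (suc j) ∘ suc))
    -- The pairs `(zero , j)` cancel against `(suc j , zero)`; the pairs with both entries positive
    -- form the same sum one size smaller.
    ≡⟨ cong₂ _+_ (sym (∑-distrib-+ (g zero) (λ j → g (suc j) zero))) (sum-antisymmetric n (λ j k → g (suc j) (suc k)) λ j k → anti (suc j) (suc k)) ⟩
  sum (λ j → g zero j + g (suc j) zero) + 0ℤ
    ≡⟨ cong (λ x → x + 0ℤ) (sum-zero λ j → trans (cong (λ x → g zero j + x) (anti zero j)) (ℤ.+-inverseʳ (g zero j))) ⟩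
  0ℤ ∎

columns : ∀ {m l} → (Fin l → Fin m) → LinearMap m l
columns π = record
  { map    = _∘ π
  ; resp   = λ p k → p (π k)
  ; linear = λ a b u v k → refl
  }

-- Expansion along both equal rows is a sum over ordered pairs of distinct columns. Exchanging the
-- two columns preserves the product of entries and the double minor but flips the sign.
detℤ-alternating : ∀ n → Alternating n (detℤ n)
detℤ-alternating zero          = tt
detℤ-alternating (suc zero)    = tt
detℤ-alternating (suc (suc n)) v M = begin
  sum (λ j → s j * (v j * sum λ k → s k * (v (punchIn j k) * d j k)))
    ≡⟨ sum-cong-≗ (λ j → trans
        (sym (ℤ.*-assoc (s j) (v j) (sum λ k → s k * (v (punchIn j k) * d j k))))
        (*-distribˡ-sum (s j * v j) λ k → s k * (v (punchIn j k) * d j k))) ⟩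
  sum (λ j → sum λ k → s j * v j * (s k * (v (punchIn j k) * d j k)))
    ≡⟨ sum-antisymmetric (suc n) _ anti ⟩
  0ℤ ∎
  where
  s : ∀ {n} → Fin n → ℤ
  s j = sign (toℕ j)
  d : Fin (suc (suc n)) → Fin (suc n) → ℤ
  d j k = detℤ n λ a b → M a (punchIn j (punchIn k b))
  anti : ∀ j k → s (punchIn j k) * v (punchIn j k) *
                   (s (pinch k j) * (v (punchIn (punchIn j k) (pinch k j)) * d (punchIn j k) (pinch k j)))
                 ≡ - (s j * v j * (s k * (v (punchIn j k) * d j k)))
  anti j k = begin
    s j′ * v j′ * (s k′ * (v (punchIn j′ k′) * d j′ k′))
      ≡⟨ cong₂ (λ x y → s j′ * v j′ * (s k′ * (x * y))) (cong v (punchIn-pinch j k))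
           (detℤ-cong n λ a b → cong (M a) (punchIn-punchIn j k b)) ⟩
    s j′ * v j′ * (s k′ * (v j * d j k))
      ≡⟨ shuffle (s j′) (v j′) (s k′) (v j) (d j k) ⟩
    (s j′ * s k′) * (v j * v j′ * d j k)
      ≡⟨ cong (_* (v j * v j′ * d j k)) (sign-punchIn j k) ⟩
    - (s j * s k) * (v j * v j′ * d j k)
      ≡⟨ unshuffle (s j) (s k) (v j) (v j′) (d j k) ⟩
    - (s j * v j * (s k * (v j′ * d j k))) ∎
    where
    j′ = punchIn j k
    k′ = pinch k j
    shuffle : ∀ a b c d e → a * b * (c * (d * e)) ≡ (a * c) * (d * b * e)
    shuffle = solve-∀
    unshuffle : ∀ a b c d e → - (a * b) * (c * d * e) ≡ - (a * c * (b * (d * e)))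
    unshuffle = solve-∀

-- With the first row held fixed, the expansion is a linear combination with constant coefficients
-- of smaller determinants composed with column deletions, which settles the lower rows by
-- induction.
detℤ-altForm : ∀ n → AltForm n (detℤ n)
detℤ-altForm zero    = tt
detℤ-altForm (suc n) =
  (λ M a b u v → trans
    (sum-cong-≗ λ j → distrib (sign (toℕ j)) a b (u j) (v j) (detℤ n (minor (u ◂ M) j)))
    (sum-linear a b (λ j → sign (toℕ j) * (u j * detℤ n (minor (u ◂ M) j)))
                    (λ j → sign (toℕ j) * (v j * detℤ n (minor (v ◂ M) j))))) ,
  detℤ-alternating (suc n) ,
  λ v → AltForm-cong n (λ M → sum-cong-≗ λ j → ℤ.*-assoc (sign (toℕ j)) (v j) (detℤ n (minor (v ◂ M) j)))
    (AltForm-sum n (λ j → sign (toℕ j) * v j) λ j →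
      AltForm-map n (columns (punchIn j)) (detℤ-cong n) (detℤ-altForm n))
  where
  distrib : ∀ s a b u v d → s * ((a * u + b * v) * d) ≡ a * (s * (u * d)) + b * (s * (v * d))
  distrib = solve-∀

-- Uniqueness of alternating forms and multiplicativity of the determinant.

insertZero : ∀ {n} → Fin (suc n) → LinearMap n (suc n)
insertZero j = record
  { map    = λ u → insertAt u j 0ℤ
  ; resp   = λ p → insert-cong j p
  ; linear = λ a b u v → insert-linear j a b u v
  }
  where
  insert-cong : ∀ {n} {u v : Row n} (j : Fin (suc n)) → u ≗ v → insertAt u j 0ℤ ≗ insertAt v j 0ℤ
  insert-cong         zero    p zero    = refl
  insert-cong         zero    p (suc k) = p k
  insert-cong {suc n} (suc j) p zero    = p zero
  insert-cong {suc n} (suc j) p (suc k) = insert-cong j (p ∘ suc) k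
  insert-linear : ∀ {n} (j : Fin (suc n)) a b u v →
    insertAt (λ k → a * u k + b * v k) j 0ℤ ≗ (λ k → a * insertAt u j 0ℤ k + b * insertAt v j 0ℤ k)
  insert-linear         zero    a b u v zero    = zeros a b
    where
    zeros : ∀ a b → 0ℤ ≡ a * 0ℤ + b * 0ℤ
    zeros = solve-∀
  insert-linear         zero    a b u v (suc k) = refl
  insert-linear {suc n} (suc j) a b u v zero    = refl
  insert-linear {suc n} (suc j) a b u v (suc k) = insert-linear j a b (tail u) (tail v) k

-- The row operation available below a first row `δ j`: it clears column `j` and leaves only the
-- minor.
insertZero-punchIn : ∀ {n} (j : Fin (suc n)) (v : Row (suc n)) →
                     (λ k → 1ℤ * v k + - v j * δ j k) ≗ insertAt (v ∘ punchIn j) j 0ℤ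
insertZero-punchIn         zero    v zero    = lemma (v zero)
  where
  lemma : ∀ x → 1ℤ * x + - x * 1ℤ ≡ 0ℤ
  lemma = solve-∀
insertZero-punchIn         zero    v (suc k) = lemma (v (suc k)) (v zero)
  where
  lemma : ∀ x y → 1ℤ * x + - y * 0ℤ ≡ x
  lemma = solve-∀
insertZero-punchIn {suc n} (suc j) v zero    = lemma (v zero) (v (suc j))
  where
  lemma : ∀ x y → 1ℤ * x + - y * 0ℤ ≡ x
  lemma = solve-∀
insertZero-punchIn {suc n} (suc j) v (suc k) = insertZero-punchIn j (tail v) k

insertZero-δ : ∀ {n} (j : Fin (suc n)) (k : Fin n) → insertAt (δ k) j 0ℤ ≗ δ (punchIn j k)
insertZero-δ zero    k       zero    = refl
insertZero-δ zero    k       (suc l) = refl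
insertZero-δ (suc j) zero    zero    = refl
insertZero-δ (suc j) zero    (suc l) = zeros j l
  where
  zeros : ∀ {n} (j l : Fin (suc n)) → insertAt (λ _ → 0ℤ) j 0ℤ l ≡ 0ℤ
  zeros         zero    zero    = refl
  zeros         zero    (suc l) = refl
  zeros {suc n} (suc j) zero    = refl
  zeros {suc n} (suc j) (suc l) = zeros j l
insertZero-δ (suc j) (suc k) zero    = refl
insertZero-δ (suc j) (suc k) (suc l) = insertZero-δ j k l

-- By linearity the first row may be taken to be a basis vector `δ j`. Column `j` below it can then
-- be cleared, and what remains is an alternating form of the minor, known by induction up to its
-- value at the identity.
altForm-unique : ∀ n {D : Matrix n n → ℤ} → Respects D → AltForm n D →
                 ∀ M → D M ≡ detℤ n M * D δ
altForm-unique zero    {D} R f M = trans (R λ ()) (sym (ℤ.*-identityˡ (D δ)))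
altForm-unique (suc n) {D} R f@(lin , alt , rest) M = begin
  D M
    ≡⟨ R (◂-tail M) ⟩
  D (head M ◂ tail M)
    ≡⟨ expand-basis (λ u → D (u ◂ tail M)) (λ p → R (◂-cong p λ _ _ → refl)) (lin (tail M)) (head M) ⟩
  sum (λ j → M zero j * D (δ j ◂ tail M))
    ≡⟨ sum-cong-≗ (λ j → trans (cong (M zero j *_) (cofactor j)) (reassoc (M zero j) (detℤ n (minor M j)) (sign (toℕ j)) (D δ))) ⟩
  sum (λ j → sign (toℕ j) * (M zero j * detℤ n (minor M j)) * D δ)
    ≡⟨ sym (*-distribʳ-sum (D δ) λ j → sign (toℕ j) * (M zero j * detℤ n (minor M j))) ⟩
  detℤ (suc n) M * D δ ∎
  where
  reassoc : ∀ m d s x → m * (d * (s * x)) ≡ s * (m * d) * x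
  reassoc = solve-∀
  cofactor : ∀ j → D (δ j ◂ tail M) ≡ detℤ n (minor M j) * (sign (toℕ j) * D δ)
  cofactor j = begin
    D (δ j ◂ tail M)
      ≡⟨ sym (add-multiples (◂-respects R (δ j)) (rest (δ j)) (δ j) (λ N i p → repeated-row R f (δ j) N i p)
              (λ i → - M (suc i) j) (tail M)) ⟩
    D (δ j ◂ λ i k → 1ℤ * M (suc i) k + - M (suc i) j * δ j k)
      ≡⟨ R (◂-cong (λ _ → refl) λ i → insertZero-punchIn j (M (suc i))) ⟩
    D′ (minor M j)
      ≡⟨ altForm-unique n (λ p → R (◂-cong (λ _ → refl) λ i → LinearMap.resp L (p i)))
           (AltForm-map n L (◂-respects R (δ j)) (rest (δ j))) (minor M j) ⟩
    detℤ n (minor M j) * D′ δ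
      -- `D′ δ` is `D` at the identity matrix with row `j` moved to the front, which accounts for
      -- the cofactor sign.
      ≡⟨ cong (detℤ n (minor M j) *_) (trans (R (◂-cong (λ _ → refl) (insertZero-δ j))) (row-to-front R f δ j)) ⟩
    detℤ n (minor M j) * (sign (toℕ j) * D δ) ∎
    where
    L = insertZero j
    D′ : Matrix n n → ℤ
    D′ N = D (δ j ◂ LinearMap.map L ∘ N)

infixl 7 _⊡_
_⊡_ : ∀ {n m l} → Matrix n m → Matrix m l → Matrix n l
(M ⊡ N) i k = sum λ j → M i j * N j k

-- For fixed `N`, the determinant of `A ⊡ N` is an alternating form in the rows of `A` whose value
-- at the identity is `detℤ n N`; uniqueness does the rest.
detℤ-⊡ : ∀ n (M N : Matrix n n) → detℤ n (M ⊡ N) ≡ detℤ n M * detℤ n N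
detℤ-⊡ n M N = trans
  (altForm-unique n {λ A → detℤ n (A ⊡ N)} (λ p → detℤ-cong n λ i → LinearMap.resp L (p i))
    (AltForm-map n L (detℤ-cong n) (detℤ-altForm n)) M)
  (cong (detℤ n M *_) (detℤ-cong n λ i k → sum-δˡ i λ j → N j k))
  where
  L : LinearMap n n
  L = record
    { map    = λ u k → sum λ j → u j * N j k
    ; resp   = λ p k → sum-cong-≗ λ j → cong (_* N j k) (p j)
    ; linear = λ a b u v k → trans (sum-cong-≗ λ j → distrib a b (u j) (v j) (N j k))
                                     (sum-linear a b (λ j → u j * N j k) (λ j → v j * N j k))
    }
    where
    distrib : ∀ a b u v x → (a * u + b * v) * x ≡ a * (u * x) + b * (v * x)
    distrib = solve-∀

detℤ-scale : ∀ n c (M : Matrix n n) → detℤ n (λ i j → c * M i j) ≡ c ^ n * detℤ n M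
detℤ-scale zero    c M = refl
detℤ-scale (suc n) c M = trans
  (sum-cong-≗ λ j → trans (cong (λ d → sign (toℕ j) * (c * M zero j * d)) (detℤ-scale n c (minor M j)))
                          (reassoc (sign (toℕ j)) c (M zero j) (c ^ n) (detℤ n (minor M j))))
  (sym (*-distribˡ-sum (c * c ^ n) λ j → sign (toℕ j) * (M zero j * detℤ n (minor M j))))
  where
  reassoc : ∀ s c m p d → s * (c * m * (p * d)) ≡ c * p * (s * (m * d))
  reassoc = solve-∀

-- Characteristic polynomials

eval : ℤ → Poly → ℤ
eval t []      = 0ℤ
eval t (a ∷ p) = a + t * eval t p

eval-⊕ : ∀ t p q → eval t (p ⊕ q) ≡ eval t p + eval t q
eval-⊕ t []      q       = sym (ℤ.+-identityˡ (eval t q))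
eval-⊕ t (a ∷ p) []      = sym (ℤ.+-identityʳ (eval t (a ∷ p)))
eval-⊕ t (a ∷ p) (b ∷ q) =
  trans (cong (λ x → a + b + t * x) (eval-⊕ t p q)) (regroup a b t (eval t p) (eval t q))
  where
  regroup : ∀ a b t x y → a + b + t * (x + y) ≡ a + t * x + (b + t * y)
  regroup = solve-∀

eval-map : ∀ t a p → eval t (List.map (a *_) p) ≡ a * eval t p
eval-map t a []      = sym (ℤ.*-zeroʳ a)
eval-map t a (b ∷ p) = trans (cong (λ x → a * b + t * x) (eval-map t a p)) (regroup a b t (eval t p))
  where
  regroup : ∀ a b t x → a * b + t * (a * x) ≡ a * (b + t * x)
  regroup = solve-∀

eval-⊗ : ∀ t p q → eval t (p ⊗ q) ≡ eval t p * eval t q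
eval-⊗ t []      q = sym (ℤ.*-zeroˡ (eval t q))
eval-⊗ t (a ∷ p) q = begin
  eval t (List.map (a *_) q ⊕ (0ℤ ∷ p ⊗ q))
    ≡⟨ eval-⊕ t (List.map (a *_) q) (0ℤ ∷ p ⊗ q) ⟩
  eval t (List.map (a *_) q) + (0ℤ + t * eval t (p ⊗ q))
    ≡⟨ cong₂ (λ x y → x + (0ℤ + t * y)) (eval-map t a q) (eval-⊗ t p q) ⟩
  a * eval t q + (0ℤ + t * (eval t p * eval t q))
    ≡⟨ regroup a t (eval t p) (eval t q) ⟩
  (a + t * eval t p) * eval t q ∎
  where
  regroup : ∀ a t x y → a * y + (0ℤ + t * (x * y)) ≡ (a + t * x) * y
  regroup = solve-∀

eval-sumP : ∀ t {n} (f : Fin n → Poly) → eval t (sumP f) ≡ sum (eval t ∘ f)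
eval-sumP t f = foldr-tabulate id
  where
  foldr-tabulate : ∀ {k} (g : Fin k → Fin _) →
    eval t (List.foldr _⊕_ [] (List.map f (List.tabulate g))) ≡ sum (λ i → eval t (f (g i)))
  foldr-tabulate {zero}  g = refl
  foldr-tabulate {suc k} g =
    trans (eval-⊕ t (f (g zero)) (List.foldr _⊕_ [] (List.map f (List.tabulate (g ∘ suc)))))
          (cong (λ x → eval t (f (g zero)) + x) (foldr-tabulate (g ∘ suc)))

eval-constant : ∀ t a → eval t (a ∷ []) ≡ a
eval-constant t a = trans (cong (λ x → a + x) (ℤ.*-zeroʳ t)) (ℤ.+-identityʳ a)

eval-det : ∀ t n (M : Fin n → Fin n → Poly) → eval t (det n M) ≡ detℤ n (λ i j → eval t (M i j))
eval-det t zero    M = eval-constant t 1ℤ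
eval-det t (suc n) M = trans (eval-sumP t λ j → (sign (toℕ j) ∷ []) ⊗ cofactor j) (sum-cong-≗ λ j → begin
  eval t ((sign (toℕ j) ∷ []) ⊗ cofactor j)
    ≡⟨ eval-⊗ t (sign (toℕ j) ∷ []) (cofactor j) ⟩
  eval t (sign (toℕ j) ∷ []) * eval t (cofactor j)
    ≡⟨ cong₂ _*_ (eval-constant t (sign (toℕ j))) (eval-⊗ t (M zero j) (det n (minorP j))) ⟩
  sign (toℕ j) * (eval t (M zero j) * eval t (det n (minorP j)))
    ≡⟨ cong (λ x → sign (toℕ j) * (eval t (M zero j) * x)) (eval-det t n (minorP j)) ⟩
  sign (toℕ j) * (eval t (M zero j) * detℤ n (λ a b → eval t (minorP j a b))) ∎)
  where
  minorP : Fin (suc n) → Fin n → Fin n → Poly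
  minorP j a b = M (suc a) (punchIn j b)
  cofactor : Fin (suc n) → Poly
  cofactor j = M zero j ⊗ det n (minorP j)

-- Evaluating at t = |a - b| + 1 forces t ∣ a - b, hence a = b.
constant-term-unique : ∀ a b (x y : ℕ → ℤ) →
  (∀ k → a + + suc k * x k ≡ b + + suc k * y k) → a ≡ b × (∀ k → x k ≡ y k)
constant-term-unique a b x y eq = a≡b , λ k →
  ℤ.*-cancelˡ-≡ (+ suc k) (x k) (y k) (∙-cancelˡ a (+ suc k * x k) (+ suc k * y k) (trans (eq k) (cong (λ z → z + + suc k * y k) (sym a≡b))))
  where
  d = ∣ a + - b ∣
  move : ∀ a b t x y → a + t * x ≡ b + t * y → a + - b ≡ t * (y + - x)
  move a b t x y e = trans (lhs a b (t * x)) (trans (cong (λ z → z + - b + - (t * x)) e) (rhs b t x y))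
    where
    lhs : ∀ a b z → a + - b ≡ a + z + - b + - z
    lhs = solve-∀
    rhs : ∀ b t x y → b + t * y + - b + - (t * x) ≡ t * (y + - x)
    rhs = solve-∀
  multiple : d ≡ suc d ℕ.* ∣ y d + - x d ∣
  multiple = trans (cong ∣_∣ (move a b (+ suc d) (x d) (y d) (eq d))) (ℤ.abs-* (+ suc d) (y d + - x d))
  vanish : ∀ m q → m ≡ suc m ℕ.* q → m ≡ 0
  vanish m zero    e = trans e (ℕ.*-zeroʳ m)
  vanish m (suc q) e = contradiction (ℕ.≤-trans (ℕ.m≤m*n (suc m) (suc q)) (ℕ.≤-reflexive (sym e))) ℕ.1+n≰n
  a≡b : a ≡ b
  a≡b = ℤ.i-j≡0⇒i≡j a b (ℤ.∣i∣≡0⇒i≡0 (vanish d _ multiple))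

-- Nonzero arguments allow the factor `t` to be cancelled after the constant terms are matched, so
-- the tails satisfy the same hypothesis. The conclusion is coefficientwise because lists may differ
-- by trailing zeros.
eval-injective : ∀ p q → (∀ k → eval (+ suc k) p ≡ eval (+ suc k) q) → ∀ i → coeff p i ≡ coeff q i
eval-injective []      []      eq i = refl
eval-injective []      (b ∷ q) eq i
  with constant-term-unique 0ℤ b (λ _ → 0ℤ) (λ k → eval (+ suc k) q)
         (λ k → trans (eval-constant (+ suc k) 0ℤ) (eq k)) | i
... | e , es | zero  = e
... | e , es | suc i = eval-injective [] q es i
eval-injective (a ∷ p) []      eq i
  with constant-term-unique a 0ℤ (λ k → eval (+ suc k) p) (λ _ → 0ℤ)
         (λ k → trans (eq k) (sym (eval-constant (+ suc k) 0ℤ))) | i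
... | e , es | zero  = e
... | e , es | suc i = eval-injective p [] es i
eval-injective (a ∷ p) (b ∷ q) eq i
  with constant-term-unique a b (λ k → eval (+ suc k) p) (λ k → eval (+ suc k) q) eq | i
... | e , es | zero  = e
... | e , es | suc i = eval-injective p q es i

charMatrix : ℤ → ∀ {n} → Graph n → Matrix n n
charMatrix t G i j = t * δ i j + - adjℤ G i j

eval-charPoly : ∀ t {n} (G : Graph n) → eval t (charPoly G) ≡ detℤ n (charMatrix t G)
eval-charPoly t {n} G = trans (eval-det t n _) (detℤ-cong n entry)
  where
  entry : ∀ i j → eval t ((if does (i ≟ j) then 0ℤ ∷ 1ℤ ∷ [] else []) ⊕ (- adjℤ G i j ∷ []))
                ≡ charMatrix t G i j
  entry i j with i ≟ j
  ... | yes _ = lemma t (- adjℤ G i j)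
    where
    lemma : ∀ t a → 0ℤ + a + t * (1ℤ + t * 0ℤ) ≡ t * 1ℤ + a
    lemma = solve-∀
  ... | no _  = lemma t (- adjℤ G i j)
    where
    lemma : ∀ t a → a + t * 0ℤ ≡ t * 0ℤ + a
    lemma = solve-∀

-- Similarity over ℚ, expressed over ℤ.

^-cancelˡ : ∀ n c .{{_ : NonZero c}} x y → c ^ n * x ≡ c ^ n * y → x ≡ y
^-cancelˡ zero    c x y eq = trans (sym (ℤ.*-identityˡ x)) (trans eq (ℤ.*-identityˡ y))
^-cancelˡ (suc n) c x y eq = ^-cancelˡ n c x y (ℤ.*-cancelˡ-≡ c (c ^ n * x) (c ^ n * y)
  (trans (sym (ℤ.*-assoc c (c ^ n) x)) (trans eq (ℤ.*-assoc c (c ^ n) y))))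

-- `Q` is `c` times the rational inverse of `P`. Multiplicativity then gives equality of the
-- determinants up to the common factor `c ^ n`, which is nonzero.
similar⇒detℤ≡ : ∀ {n} (A B P Q : Matrix n n) c .{{_ : NonZero c}} →
                A ⊡ P ≈ P ⊡ B → P ⊡ Q ≈ (λ i j → c * δ i j) → detℤ n A ≡ detℤ n B
similar⇒detℤ≡ {n} A B P Q c AP≈PB PQ≈c = ^-cancelˡ n c (detℤ n A) (detℤ n B) (begin
  c ^ n * detℤ n A                       ≡⟨ scale A ⟩
  detℤ n P * detℤ n Q * detℤ n A         ≡⟨ rotate (detℤ n P) (detℤ n Q) (detℤ n A) ⟩
  detℤ n A * detℤ n P * detℤ n Q         ≡⟨ cong (λ x → x * detℤ n Q) (trans (sym (detℤ-⊡ n A P)) (trans (detℤ-cong n AP≈PB) (detℤ-⊡ n P B))) ⟩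
  detℤ n P * detℤ n B * detℤ n Q         ≡⟨ swap (detℤ n P) (detℤ n B) (detℤ n Q) ⟩
  detℤ n P * detℤ n Q * detℤ n B         ≡⟨ sym (scale B) ⟩
  c ^ n * detℤ n B                       ∎)
  where
  rotate : ∀ p q a → p * q * a ≡ a * p * q
  rotate = solve-∀
  swap : ∀ p b q → p * b * q ≡ p * q * b
  swap = solve-∀
  scale : ∀ M → c ^ n * detℤ n M ≡ detℤ n P * detℤ n Q * detℤ n M
  scale M = begin
    c ^ n * detℤ n M                 ≡⟨ sym (detℤ-scale n c M) ⟩
    detℤ n (λ i k → c * M i k)       ≡⟨ detℤ-cong n (λ i k → sym (begin
      sum (λ j → (P ⊡ Q) i j * M j k)  ≡⟨ sum-cong-≗ (λ j → trans (cong (λ x → x * M j k) (PQ≈c i j)) (ℤ.*-assoc c (δ i j) (M j k))) ⟩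
      sum (λ j → c * (δ i j * M j k))  ≡⟨ sym (*-distribˡ-sum c λ j → δ i j * M j k) ⟩
      c * sum (λ j → δ i j * M j k)    ≡⟨ cong (λ x → c * x) (sum-δˡ i λ j → M j k) ⟩
      c * M i k                        ∎)) ⟩
    detℤ n ((P ⊡ Q) ⊡ M)             ≡⟨ detℤ-⊡ n (P ⊡ Q) M ⟩
    detℤ n (P ⊡ Q) * detℤ n M        ≡⟨ cong (λ x → x * detℤ n M) (detℤ-⊡ n P Q) ⟩
    detℤ n P * detℤ n Q * detℤ n M   ∎

-- Scalar matrices commute with `P`, so `P` also intertwines the characteristic matrices at every
-- integer `t`.
similar⇒isospectral : ∀ {n} (G H : Graph n) (P Q : Matrix n n) c .{{_ : NonZero c}} →
  adjℤ G ⊡ P ≈ P ⊡ adjℤ H → P ⊡ Q ≈ (λ i j → c * δ i j) → Isospectral G H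
similar⇒isospectral {n} G H P Q c GP≈PH PQ≈c =
  eval-injective (charPoly G) (charPoly H) λ k → begin
    eval (+ suc k) (charPoly G)       ≡⟨ eval-charPoly (+ suc k) G ⟩
    detℤ n (charMatrix (+ suc k) G)   ≡⟨ similar⇒detℤ≡ _ _ P Q c (intertwine (+ suc k)) PQ≈c ⟩
    detℤ n (charMatrix (+ suc k) H)   ≡⟨ sym (eval-charPoly (+ suc k) H) ⟩
    eval (+ suc k) (charPoly H)       ∎
  where
  left : ∀ t d a p → (t * d + - a) * p ≡ t * (d * p) + - 1ℤ * (a * p)
  left = solve-∀
  right : ∀ t d a p → p * (t * d + - a) ≡ t * (p * d) + - 1ℤ * (p * a)
  right = solve-∀
  intertwine : ∀ t → charMatrix t G ⊡ P ≈ P ⊡ charMatrix t H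
  intertwine t i k = begin
    sum (λ j → (t * δ i j + - adjℤ G i j) * P j k)
      ≡⟨ sum-cong-≗ (λ j → left t (δ i j) (adjℤ G i j) (P j k)) ⟩
    sum (λ j → t * (δ i j * P j k) + - 1ℤ * (adjℤ G i j * P j k))
      ≡⟨ sum-linear t (- 1ℤ) (λ j → δ i j * P j k) (λ j → adjℤ G i j * P j k) ⟩
    t * sum (λ j → δ i j * P j k) + - 1ℤ * (adjℤ G ⊡ P) i k
      ≡⟨ cong₂ (λ x y → t * x + - 1ℤ * y)
           (trans (sum-δˡ i λ j → P j k) (sym (sum-δʳ k (P i)))) (GP≈PH i k) ⟩
    t * sum (λ j → P i j * δ j k) + - 1ℤ * (P ⊡ adjℤ H) i k
      ≡⟨ sym (sum-linear t (- 1ℤ) (λ j → P i j * δ j k) (λ j → P i j * adjℤ H j k)) ⟩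
    sum (λ j → t * (P i j * δ j k) + - 1ℤ * (P i j * adjℤ H j k))
      ≡⟨ sum-cong-≗ (λ j → sym (right t (δ j k) (adjℤ H j k) (P i j))) ⟩
    sum (λ j → P i j * (t * δ j k + - adjℤ H j k)) ∎

-- Lifts of graphs

indicator : Bool → ℕ
indicator b = if b then 1 else 0

degree-sum : ∀ {n} (G : Graph n) i → degree G i ≡ sumℕ λ j → indicator (adj G i j)
degree-sum G i = foldr-tabulate id
  where
  foldr-tabulate : ∀ {k} (g : Fin k → Fin _) →
    List.foldr ℕ._+_ 0 (List.map (λ j → indicator (adj G i j)) (List.tabulate g)) ≡ sumℕ (λ j → indicator (adj G i (g j)))
  foldr-tabulate {zero}  g = refl
  foldr-tabulate {suc k} g = cong (indicator (adj G i (g zero)) ℕ.+_) (foldr-tabulate (g ∘ suc))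

sumℕ-const : ∀ n c → sumℕ {n} (λ _ → c) ≡ n ℕ.* c
sumℕ-const zero    c = refl
sumℕ-const (suc n) c = cong (c ℕ.+_) (sumℕ-const n c)

sumℕ-≟ : ∀ {n} b (i : Fin n) → sumℕ (λ j → indicator (b ∧ does (i ≟ j))) ≡ indicator b
sumℕ-≟ {n} false i             = trans (sumℕ-const n 0) (ℕ.*-zeroʳ n)
sumℕ-≟ {suc n} true zero       = cong suc (trans (sumℕ-const n 0) (ℕ.*-zeroʳ n))
sumℕ-≟ {suc n} true (suc i)    = sumℕ-≟ true i

complete : ∀ n → Graph n
complete n = record
  { adj    = λ i j → not (does (i ≟ j))
  ; sym    = λ i j → cong not (does-⇔ (mk⇔ sym sym) (i ≟ j) (j ≟ i))
  ; irrefl = λ i → cong not (dec-true (i ≟ i) refl)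
  }

complete-adj⁻ : ∀ {n} (i j : Fin n) → adj (complete n) i j ≡ true → i ≢ j
complete-adj⁻ i j e with i ≟ j
complete-adj⁻ i j () | yes _
complete-adj⁻ i j e  | no i≢j = i≢j

complete-adj⁺ : ∀ {n} {i j : Fin n} → i ≢ j → adj (complete n) i j ≡ true
complete-adj⁺ {i = i} {j} i≢j = cong not (dec-false (i ≟ j) i≢j)

degree-complete : ∀ n i → degree (complete (suc n)) i ≡ n
degree-complete n i = trans (degree-sum (complete (suc n)) i) (count n i)
  where
  count : ∀ n (i : Fin (suc n)) → sumℕ (λ j → indicator (not (does (i ≟ j)))) ≡ n
  count n       zero    = trans (sumℕ-const n 1) (ℕ.*-identityʳ n)
  count (suc n) (suc i) = cong suc (count n i)

-- A permutation voltage assignment: applied to an edge in both directions, `inverse` makes each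
-- `act u v` a bijection. The restriction to edges matters for `kleinVoltage`, whose action depends
-- on the copy of the source and is undone only if both ends lie in the same copy.
record Voltage {N} (H : Graph N) (s : ℕ) : Set where
  field
    act     : Fin N → Fin N → Fin s → Fin s
    inverse : ∀ u v x → adj H u v ≡ true → act v u (act u v x) ≡ x
open Voltage

module _ {N s} (H : Graph N) (τ : Voltage H s) where

  liftAdj : Fin N × Fin s → Fin N × Fin s → Bool
  liftAdj (u , x) (v , y) = adj H u v ∧ does (act τ u v x ≟ y)

  lift : Graph (N ℕ.* s)
  lift = record
    { adj    = λ i j → liftAdj (remQuot {N} s i) (remQuot {N} s j)
    ; sym    = λ i j → liftAdj-sym (remQuot {N} s i) (remQuot {N} s j)
    ; irrefl = λ i → cong (_∧ _) (irrefl H (quotient {N} s i))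
    }
    where
    liftAdj-sym : ∀ p q → liftAdj p q ≡ liftAdj q p
    liftAdj-sym (u , x) (v , y) with adj H u v in uv | adj H v u in vu
    ... | false | false = refl
    ... | true  | false = contradiction (trans (sym uv) (trans (Graph.sym H u v) vu)) λ ()
    ... | false | true  = contradiction (trans (sym vu) (trans (Graph.sym H v u) uv)) λ ()
    ... | true  | true  = does-⇔ (mk⇔ (λ e → trans (cong (act τ v u) (sym e)) (inverse τ u v x uv))
                                      (λ e → trans (cong (act τ u v) (sym e)) (inverse τ v u y vu)))
                              (act τ u v x ≟ y) (act τ v u y ≟ x)

  lift-combine : ∀ u x v y → adj lift (combine u x) (combine v y) ≡ liftAdj (u , x) (v , y)
  lift-combine u x v y = cong₂ liftAdj (remQuot-combine u x) (remQuot-combine v y)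

  liftAdj⁻ : ∀ u x v y → liftAdj (u , x) (v , y) ≡ true → adj H u v ≡ true × act τ u v x ≡ y
  liftAdj⁻ u x v y e with adj H u v | act τ u v x ≟ y
  liftAdj⁻ u x v y e  | true  | yes p = refl , p
  liftAdj⁻ u x v y () | true  | no _
  liftAdj⁻ u x v y () | false | _

  liftAdj⁺ : ∀ u x v y → adj H u v ≡ true → act τ u v x ≡ y → liftAdj (u , x) (v , y) ≡ true
  liftAdj⁺ u x v y uv e = cong₂ _∧_ uv (dec-true (act τ u v x ≟ y) e)

  -- Over each neighbour `v` of the base vertex `u` there is exactly one neighbour of `(u , x)`,
  -- namely `act τ u v x`.
  degree-lift : ∀ i → degree lift i ≡ degree H (quotient {N} s i)
  degree-lift i = begin
    degree lift i
      ≡⟨ degree-sum lift i ⟩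
    sumℕ (λ j → indicator (liftAdj (remQuot {N} s i) (remQuot {N} s j)))
      ≡⟨ sumℕ-combine N s (λ j → indicator (liftAdj (remQuot {N} s i) (remQuot {N} s j))) ⟩
    sumℕ {N} (λ v → sumℕ {s} λ y → indicator (liftAdj (remQuot {N} s i) (remQuot {N} s (combine v y))))
      ≡⟨ sumℕ-cong (λ v → trans
           (sumℕ-cong λ y → cong (indicator ∘ liftAdj (remQuot {N} s i)) (remQuot-combine v y))
           (sumℕ-≟ (adj H (quotient {N} s i) v) (act τ (quotient {N} s i) v (remainder {N} s i)))) ⟩
    sumℕ (λ v → indicator (adj H (quotient {N} s i) v))
      ≡⟨ sym (degree-sum H (quotient {N} s i)) ⟩
    degree H (quotient {N} s i) ∎

  adjℤ-lift : ∀ i v y → adjℤ lift i (combine v y)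
                      ≡ adjℤ H (quotient {N} s i) v * δ (act τ (quotient {N} s i) v (remainder {N} s i)) y
  adjℤ-lift i v y = trans
    (cong (λ q → if liftAdj (remQuot {N} s i) q then 1ℤ else 0ℤ) (remQuot-combine v y))
    (if-∧ (adj H (quotient {N} s i) v) (does (act τ (quotient {N} s i) v (remainder {N} s i) ≟ y)))
    where
    if-∧ : ∀ b c → (if b ∧ c then 1ℤ else 0ℤ) ≡ (if b then 1ℤ else 0ℤ) * (if c then 1ℤ else 0ℤ)
    if-∧ false false = refl
    if-∧ false true  = refl
    if-∧ true  false = refl
    if-∧ true  true  = refl

-- Block-diagonal intertwiners between lifts.

δ-combine : ∀ {m n} (i k : Fin (m ℕ.* n)) →
            δ i k ≡ δ (quotient {m} n i) (quotient {m} n k) * δ (remainder {m} n i) (remainder {m} n k)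
δ-combine {m} {n} i k with i ≟ k
... | yes refl = sym (cong₂ _*_ (δ-refl (quotient {m} n i)) (δ-refl (remainder {m} n i)))
  where
  δ-refl : ∀ {n} (j : Fin n) → δ j j ≡ 1ℤ
  δ-refl j = cong (if_then 1ℤ else 0ℤ) (dec-true (j ≟ j) refl)
... | no i≢k with quotient {m} n i ≟ quotient {m} n k | remainder {m} n i ≟ remainder {m} n k
...   | no _  | no _  = refl
...   | no _  | yes _ = refl
...   | yes _ | no _  = refl
...   | yes p | yes q = contradiction
        (trans (sym (combine-remQuot {m} n i)) (trans (cong₂ combine p q) (combine-remQuot {m} n k))) i≢k

δ-adjoint : ∀ {n} (f g : Fin n → Fin n) → (∀ x → g (f x) ≡ x) → (∀ x → f (g x) ≡ x) →
            ∀ x y → δ (f x) y ≡ δ x (g y)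
δ-adjoint f g gf fg x y = cong (if_then 1ℤ else 0ℤ)
  (does-⇔ (mk⇔ (λ e → trans (sym (gf x)) (cong g e)) (λ e → trans (cong f e) (fg y))) (f x ≟ y) (x ≟ g y))

block : ∀ {N s} → (Fin N → Matrix s s) → Matrix (N ℕ.* s) (N ℕ.* s)
block {N} {s} P i k =
  δ (quotient {N} s i) (quotient {N} s k) * P (quotient {N} s i) (remainder {N} s i) (remainder {N} s k)

module _ {N s : ℕ} (P : Fin N → Matrix s s) where

  block-combineˡ : ∀ v y k → block P (combine v y) k ≡ δ v (quotient {N} s k) * P v y (remainder {N} s k)
  block-combineˡ v y k =
    cong (λ (u , x) → δ u (quotient {N} s k) * P u x (remainder {N} s k)) (remQuot-combine v y)

  block-combineʳ : ∀ i v y → block P i (combine v y)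
                           ≡ δ (quotient {N} s i) v * P (quotient {N} s i) (remainder {N} s i) y
  block-combineʳ i v y =
    cong (λ (w , z) → δ (quotient {N} s i) w * P (quotient {N} s i) (remainder {N} s i) z) (remQuot-combine v y)

  block-⊡ : ∀ {l} (M : Matrix (N ℕ.* s) l) i k →
            (block P ⊡ M) i k ≡ sum λ y → P (quotient {N} s i) (remainder {N} s i) y * M (combine (quotient {N} s i) y) k
  block-⊡ M i k = begin
    sum (λ j → block P i j * M j k)
      ≡⟨ sum-combine N s (λ j → block P i j * M j k) ⟩
    sum {N} (λ v → sum {s} λ y → block P i (combine v y) * M (combine v y) k)
      ≡⟨ sum-cong-≗ (λ v → trans
           (sum-cong-≗ λ y → trans (cong (λ z → z * M (combine v y) k) (block-combineʳ i v y))
                                   (ℤ.*-assoc (δ u v) (P u x y) (M (combine v y) k)))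
           (sym (*-distribˡ-sum (δ u v) λ y → P u x y * M (combine v y) k))) ⟩
    sum (λ v → δ u v * sum λ y → P u x y * M (combine v y) k)
      ≡⟨ sum-δˡ u (λ v → sum λ y → P u x y * M (combine v y) k) ⟩
    sum (λ y → P u x y * M (combine u y) k) ∎
    where
    u = quotient {N} s i
    x = remainder {N} s i

block-⊡-block : ∀ {N s} (P Q : Fin N → Matrix s s) c → (∀ u → P u ⊡ Q u ≈ λ x z → c * δ x z) →
                block P ⊡ block Q ≈ λ i k → c * δ i k
block-⊡-block {N} {s} P Q c PQ≈c i k = begin
  (block P ⊡ block Q) i k
    ≡⟨ block-⊡ P (block Q) i k ⟩
  sum (λ y → P u x y * block Q (combine u y) k)
    ≡⟨ sum-cong-≗ (λ y → trans (cong (λ b → P u x y * b) (block-combineˡ Q u y k))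
                               (rotate (P u x y) (δ u w) (Q u y z))) ⟩
  sum (λ y → δ u w * (P u x y * Q u y z))
    ≡⟨ sym (*-distribˡ-sum (δ u w) λ y → P u x y * Q u y z) ⟩
  δ u w * (P u ⊡ Q u) x z
    ≡⟨ cong (λ b → δ u w * b) (PQ≈c u x z) ⟩
  δ u w * (c * δ x z)
    ≡⟨ rotate′ c (δ u w) (δ x z) ⟩
  c * (δ u w * δ x z)
    ≡⟨ cong (λ b → c * b) (sym (δ-combine {N} {s} i k)) ⟩
  c * δ i k ∎
  where
  u = quotient {N} s i
  x = remainder {N} s i
  w = quotient {N} s k
  z = remainder {N} s k
  rotate : ∀ p d q → p * (d * q) ≡ d * (p * q)
  rotate = solve-∀
  rotate′ : ∀ c d e → d * (c * e) ≡ c * (d * e)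
  rotate′ = solve-∀

-- The first hypothesis on `P` says `T ⊡ P v ≈ P u ⊡ S` for the permutation matrices `T` of
-- `act τ u v` and `S` of `act σ u v`, read entry by entry; on the column index the inverse
-- permutation `act σ v u` appears. These are the blocks of the intertwining relation for `block P`.
lift-isospectral : ∀ {N s} (H : Graph N) (τ σ : Voltage H s) (P Q : Fin N → Matrix s s) c .{{_ : NonZero c}} →
  (∀ u v → adj H u v ≡ true → ∀ x z → P v (act τ u v x) z ≡ P u x (act σ v u z)) →
  (∀ u → P u ⊡ Q u ≈ λ x z → c * δ x z) →
  Isospectral (lift H τ) (lift H σ)
lift-isospectral {N} {s} H τ σ P Q c equivariant PQ≈c =
  similar⇒isospectral (lift H τ) (lift H σ) (block P) (block Q) c intertwine (block-⊡-block P Q c PQ≈c)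
  where
  intertwine : adjℤ (lift H τ) ⊡ block P ≈ block P ⊡ adjℤ (lift H σ)
  intertwine i k = begin
    sum (λ j → adjℤ (lift H τ) i j * block P j k)
      ≡⟨ sum-combine N s (λ j → adjℤ (lift H τ) i j * block P j k) ⟩
    sum {N} (λ v → sum {s} λ y → adjℤ (lift H τ) i (combine v y) * block P (combine v y) k)
      ≡⟨ sum-cong-≗ (λ v → trans
           (sum-cong-≗ λ y → trans (cong₂ _*_ (adjℤ-lift H τ i v y) (block-combineˡ P v y k))
                                   (rearrange (adjℤ H u v) (δ (act τ u v x) y) (δ v w) (P v y z)))
           (sum-δˡ (act τ u v x) λ y → adjℤ H u v * P v y z * δ v w)) ⟩
    sum (λ v → adjℤ H u v * P v (act τ u v x) z * δ v w)
      ≡⟨ sum-δʳ w (λ v → adjℤ H u v * P v (act τ u v x) z) ⟩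
    adjℤ H u w * P w (act τ u w x) z
      ≡⟨ on-edges ⟩
    adjℤ H u w * sum (λ y → P u x y * δ (act σ u w y) z)
      ≡⟨ *-distribˡ-sum (adjℤ H u w) (λ y → P u x y * δ (act σ u w y) z) ⟩
    sum (λ y → adjℤ H u w * (P u x y * δ (act σ u w y) z))
      ≡⟨ sum-cong-≗ (λ y → sym (trans (cong (λ b → P u x y * b) (adjℤ-lift′ y)) (rotate (P u x y) (adjℤ H u w) (δ (act σ u w y) z)))) ⟩
    sum (λ y → P u x y * adjℤ (lift H σ) (combine u y) k)
      ≡⟨ sym (block-⊡ P (adjℤ (lift H σ)) i k) ⟩
    (block P ⊡ adjℤ (lift H σ)) i k ∎
    where
    u = quotient {N} s i
    x = remainder {N} s i
    w = quotient {N} s k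
    z = remainder {N} s k
    rearrange : ∀ a d e p → a * d * (e * p) ≡ d * (a * p * e)
    rearrange = solve-∀
    rotate : ∀ p d q → p * (d * q) ≡ d * (p * q)
    rotate = solve-∀
    adjℤ-lift′ : ∀ y → adjℤ (lift H σ) (combine u y) k ≡ adjℤ H u w * δ (act σ u w y) z
    adjℤ-lift′ y = trans
      (cong (adjℤ (lift H σ) (combine u y)) (sym (combine-remQuot {N} s k)))
      (trans (adjℤ-lift H σ (combine u y) w z)
             (cong (λ (u , y) → adjℤ H u w * δ (act σ u w y) z) (remQuot-combine u y)))
    -- Equivariance is available on edges only; elsewhere the factor `adjℤ H u w` makes both sides
    -- vanish.
    on-edges : adjℤ H u w * P w (act τ u w x) z ≡ adjℤ H u w * sum (λ y → P u x y * δ (act σ u w y) z)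
    on-edges with adj H u w in uw
    ... | false = refl
    ... | true  = cong (λ b → 1ℤ * b) (begin
      P w (act τ u w x) z                        ≡⟨ equivariant u w uw x z ⟩
      P u x (act σ w u z)                        ≡⟨ sym (sum-δʳ (act σ w u z) (P u x)) ⟩
      sum (λ y → P u x y * δ y (act σ w u z))
        ≡⟨ sum-cong-≗ (λ y → cong (λ b → P u x y * b) (sym
             (δ-adjoint (act σ u w) (act σ w u) (λ y → inverse σ u w y uw)
               (λ z → inverse σ w u z (trans (Graph.sym H w u) uw)) y z))) ⟩
      sum (λ y → P u x y * δ (act σ u w y) z)    ∎)

-- Simplicial vertices

Simplicial : ∀ {n} → Graph n → Fin n → Set
Simplicial G v = ∀ a b → adj G v a ≡ true → adj G v b ≡ true → a ≢ b → adj G a b ≡ true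

simplicial? : ∀ {n} (G : Graph n) v → Dec (Simplicial G v)
simplicial? G v = all? λ a → all? λ b →
  (adj G v a Bool.≟ true) →-dec ((adj G v b Bool.≟ true) →-dec (¬? (a ≟ b) →-dec (adj G a b Bool.≟ true)))

simplicialCount : ∀ {n} → Graph n → ℕ
simplicialCount G = sumℕ λ v → indicator (does (simplicial? G v))

simplicialCount-iso : ∀ {n m} (G : Graph n) (H : Graph m) → Isomorphic G H →
                      simplicialCount G ≡ simplicialCount H
simplicialCount-iso G H (e , e-adj) = sym (trans
  (sumℕ-permute (λ v → indicator (does (simplicial? H v))) e)
  (sumℕ-cong λ v → cong indicator (does-⇔ (mk⇔ (backward v) (forward v)) (simplicial? H (to v)) (simplicial? G v))))
  where
  open Inverse e using (to; from; strictlyInverseˡ; strictlyInverseʳ)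
  to-injective : ∀ {a b} → to a ≡ to b → a ≡ b
  to-injective {a} {b} p = trans (sym (strictlyInverseʳ a)) (trans (cong from p) (strictlyInverseʳ b))
  backward : ∀ v → Simplicial H (to v) → Simplicial G v
  backward v simp a b va vb a≢b = trans (e-adj a b)
    (simp (to a) (to b) (trans (sym (e-adj v a)) va) (trans (sym (e-adj v b)) vb) (a≢b ∘ to-injective))
  forward : ∀ v → Simplicial G v → Simplicial H (to v)
  forward v simp a b va vb a≢b = trans
    (sym (trans (e-adj (from a) (from b)) (cong₂ (adj H) (strictlyInverseˡ a) (strictlyInverseˡ b))))
    (simp (from a) (from b)
      (trans (e-adj v (from a)) (trans (cong (adj H (to v)) (strictlyInverseˡ a)) va))
      (trans (e-adj v (from b)) (trans (cong (adj H (to v)) (strictlyInverseˡ b)) vb))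
      λ p → a≢b (trans (sym (strictlyInverseˡ a)) (trans (cong to p) (strictlyInverseˡ b))))

-- V = {1, s, t, st}, the Klein four-group, acts on six points in two ways: on V ⊔ 1 ⊔ 1 (true) and
-- on V/⟨s⟩ ⊔ V/⟨t⟩ ⊔ V/⟨st⟩ (false).  The elements 1, s, t are numbered 0, 1, 2.
kleinAct : Bool → Fin 3 → Fin 6 → Fin 6
kleinAct _     0F x = x
kleinAct true  1F   = lookup (1F ∷ 0F ∷ 3F ∷ 2F ∷ 4F ∷ 5F ∷ [])
kleinAct true  2F   = lookup (2F ∷ 3F ∷ 0F ∷ 1F ∷ 4F ∷ 5F ∷ [])
kleinAct false 1F   = lookup (0F ∷ 1F ∷ 3F ∷ 2F ∷ 5F ∷ 4F ∷ [])
kleinAct false 2F   = lookup (1F ∷ 0F ∷ 2F ∷ 3F ∷ 5F ∷ 4F ∷ [])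

kleinAct-involutive : ∀ β g x → kleinAct β g (kleinAct β g x) ≡ x
kleinAct-involutive true  = from-yes (all? λ g → all? λ x → kleinAct true g (kleinAct true g x) ≟ x)
kleinAct-involutive false = from-yes (all? λ g → all? λ x → kleinAct false g (kleinAct false g x) ≟ x)

-- The Brauer relation of V: over ℚ the two permutation modules are isomorphic.  Below, an element of V
-- is sent to the sum of the three cosets containing it.
intertwiner : Bool → Matrix 6 6
intertwiner true  x z = lookup (lookup
  ( (1ℤ ∷ 0ℤ ∷ 1ℤ ∷ 0ℤ ∷ 1ℤ ∷ 0ℤ ∷ [])
  ∷ (1ℤ ∷ 0ℤ ∷ 0ℤ ∷ 1ℤ ∷ 0ℤ ∷ 1ℤ ∷ [])
  ∷ (0ℤ ∷ 1ℤ ∷ 1ℤ ∷ 0ℤ ∷ 0ℤ ∷ 1ℤ ∷ [])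
  ∷ (0ℤ ∷ 1ℤ ∷ 0ℤ ∷ 1ℤ ∷ 1ℤ ∷ 0ℤ ∷ [])
  ∷ (-1ℤ ∷ -1ℤ ∷ -1ℤ ∷ -1ℤ ∷ 0ℤ ∷ 0ℤ ∷ [])
  ∷ (-1ℤ ∷ -1ℤ ∷ 0ℤ ∷ 0ℤ ∷ -1ℤ ∷ -1ℤ ∷ [])
  ∷ []) x) z
intertwiner false = δ

-- The inverse of `intertwiner true` has half-integral entries. The unchanged copies carry the same
-- factor 2, so that one constant serves all blocks.
twiceInverse : Bool → Matrix 6 6
twiceInverse true  x z = lookup (lookup
  ( (0ℤ ∷ 0ℤ ∷ -1ℤ ∷ -1ℤ ∷ -1ℤ ∷ -1ℤ ∷ [])
  ∷ (-1ℤ ∷ -1ℤ ∷ 0ℤ ∷ 0ℤ ∷ -1ℤ ∷ -1ℤ ∷ [])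
  ∷ (1ℤ ∷ 0ℤ ∷ 1ℤ ∷ 0ℤ ∷ 0ℤ ∷ 1ℤ ∷ [])
  ∷ (0ℤ ∷ 1ℤ ∷ 0ℤ ∷ 1ℤ ∷ 0ℤ ∷ 1ℤ ∷ [])
  ∷ (1ℤ ∷ 0ℤ ∷ 0ℤ ∷ 1ℤ ∷ 1ℤ ∷ 0ℤ ∷ [])
  ∷ (0ℤ ∷ 1ℤ ∷ 1ℤ ∷ 0ℤ ∷ 1ℤ ∷ 0ℤ ∷ [])
  ∷ []) x) z
twiceInverse false x z = + 2 * δ x z

-- Elements of V are their own inverses, so `g` itself can appear on the column index.
intertwiner-equivariant : ∀ β g x z →
  intertwiner β (kleinAct β g x) z ≡ intertwiner β x (kleinAct false g z)
intertwiner-equivariant true  = from-yes (all? λ g → all? λ x → all? λ z →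
  intertwiner true (kleinAct true g x) z ℤ.≟ intertwiner true x (kleinAct false g z))
intertwiner-equivariant false = from-yes (all? λ g → all? λ x → all? λ z →
  intertwiner false (kleinAct false g x) z ℤ.≟ intertwiner false x (kleinAct false g z))

-- In the case `true`, each nontrivial character of V occurs once on either side and survives the
-- summation of cosets. On invariants, let A, B, C be the three orbit sums: the sum over V goes to
-- 2(A + B + C), and the two trivial points go to -(A + B) and -(A + C), so all three are reached
-- over ℚ.
intertwiner-inverse : ∀ β → intertwiner β ⊡ twiceInverse β ≈ λ x z → + 2 * δ x z
intertwiner-inverse true  = from-yes (all? λ x → all? λ z → (intertwiner true ⊡ twiceInverse true) x z ℤ.≟ + 2 * δ x z)
intertwiner-inverse false = from-yes (all? λ x → all? λ z → (intertwiner false ⊡ twiceInverse false) x z ℤ.≟ + 2 * δ x z)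

-- Since s and t generate V, this is invariance under the whole group although st has no number.
Fixed : Bool → Fin 6 → Set
Fixed β x = ∀ g → kleinAct β g x ≡ x

fixed? : ∀ β x → Dec (Fixed β x)
fixed? β x = all? λ g → kleinAct β g x ≟ x

-- The family of `m` graphs of degree `l + 3`.

module Family (l m : ℕ) where

  n : ℕ
  n = suc (suc (suc (suc l)))

  -- The edges 01 and 23 are disjoint, so a triangle contains at most one of them and its net
  -- voltage is the voltage of that edge. Four vertices are needed to place them.
  voltage : Fin n → Fin n → Fin 3
  voltage 0F 1F = 1F
  voltage 1F 0F = 1F
  voltage 2F 3F = 2F
  voltage 3F 2F = 2F
  voltage _  _  = 0F

  voltage-sym : ∀ a b → voltage a b ≡ voltage b a
  voltage-sym 0F 0F = refl
  voltage-sym 0F 1F = refl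
  voltage-sym 0F 2F = refl
  voltage-sym 0F 3F = refl
  voltage-sym 0F (suc (suc (suc (suc b)))) = refl
  voltage-sym 1F 0F = refl
  voltage-sym 1F 1F = refl
  voltage-sym 1F 2F = refl
  voltage-sym 1F 3F = refl
  voltage-sym 1F (suc (suc (suc (suc b)))) = refl
  voltage-sym 2F 0F = refl
  voltage-sym 2F 1F = refl
  voltage-sym 2F 2F = refl
  voltage-sym 2F 3F = refl
  voltage-sym 2F (suc (suc (suc (suc b)))) = refl
  voltage-sym 3F 0F = refl
  voltage-sym 3F 1F = refl
  voltage-sym 3F 2F = refl
  voltage-sym 3F 3F = refl
  voltage-sym 3F (suc (suc (suc (suc b)))) = refl
  voltage-sym (suc (suc (suc (suc a)))) 0F = refl
  voltage-sym (suc (suc (suc (suc a)))) 1F = refl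
  voltage-sym (suc (suc (suc (suc a)))) 2F = refl
  voltage-sym (suc (suc (suc (suc a)))) 3F = refl
  voltage-sym (suc (suc (suc (suc a)))) (suc (suc (suc (suc b)))) = refl

  -- A disjoint union of `m` copies is a lift with identity voltages, so the lemmas on lifts also
  -- give its degrees and adjacencies.
  trivial : Voltage (complete n) m
  trivial = record { act = λ _ _ → id ; inverse = λ _ _ _ _ → refl }

  base : Graph (n ℕ.* m)
  base = lift (complete n) trivial

  position : Fin (n ℕ.* m) → Fin n
  position = quotient {n} m

  copy : Fin (n ℕ.* m) → Fin m
  copy = remainder {n} m

  same-copy : ∀ p q → adj base p q ≡ true → copy p ≡ copy q
  same-copy p q e = proj₂ (liftAdj⁻ (complete n) trivial (position p) (copy p) (position q) (copy q) e)

  -- The group-valued voltages are the same for every `β`; the value `β k` only selects the V-set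
  -- attached to copy `k`. All members thus share one base and one vertex set.
  kleinVoltage : (Fin m → Bool) → Voltage base 6
  kleinVoltage β = record
    { act     = λ p q → kleinAct (β (copy p)) (voltage (position p) (position q))
    ; inverse = λ p q x pq → trans
        (cong₂ (λ k g → kleinAct (β k) g (kleinAct (β (copy p)) (voltage (position p) (position q)) x))
               (sym (same-copy p q pq)) (voltage-sym (position q) (position p)))
        (kleinAct-involutive (β (copy p)) (voltage (position p) (position q)) x)
    }

  graph : (Fin m → Bool) → Graph (n ℕ.* m ℕ.* 6)
  graph β = lift base (kleinVoltage β)

  graph-regular : ∀ β → Regular (suc (suc (suc l))) (graph β)
  graph-regular β i = trans (degree-lift base (kleinVoltage β) i)
    (trans (degree-lift (complete n) trivial (quotient {n ℕ.* m} 6 i)) (degree-complete (suc (suc (suc l))) (position (quotient {n ℕ.* m} 6 i))))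

  -- With the all-`false` graph as common reference, an intertwiner in one direction suffices, and
  -- mixed choices of `β` become mixed choices of blocks.
  graph-isospectral : ∀ β → Isospectral (graph β) (graph λ _ → false)
  graph-isospectral β = lift-isospectral base (kleinVoltage β) (kleinVoltage λ _ → false)
    (intertwiner ∘ β ∘ copy) (twiceInverse ∘ β ∘ copy) (+ 2)
    (λ p q pq x z → begin
      intertwiner (β (copy q)) (kleinAct (β (copy p)) (voltage (position p) (position q)) x) z
        ≡⟨ cong (λ k → intertwiner (β k) (kleinAct (β (copy p)) (voltage (position p) (position q)) x) z)
             (sym (same-copy p q pq)) ⟩
      intertwiner (β (copy p)) (kleinAct (β (copy p)) (voltage (position p) (position q)) x) z
        ≡⟨ intertwiner-equivariant (β (copy p)) (voltage (position p) (position q)) x z ⟩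
      intertwiner (β (copy p)) x (kleinAct false (voltage (position p) (position q)) z)
        ≡⟨ cong (λ g → intertwiner (β (copy p)) x (kleinAct false g z)) (voltage-sym (position p) (position q)) ⟩
      intertwiner (β (copy p)) x (kleinAct false (voltage (position q) (position p)) z) ∎)
    (λ p → intertwiner-inverse (β (copy p)))

  vertex : Fin n → Fin m → Fin 6 → Fin (n ℕ.* m ℕ.* 6)
  vertex a k x = combine (combine a k) x

  vertex-surjective : ∀ v → Σ (Fin n) λ a → Σ (Fin m) λ k → Σ (Fin 6) λ x → vertex a k x ≡ v
  vertex-surjective v with combine-surjective {n ℕ.* m} {6} v
  ... | p , x , refl with combine-surjective {n} {m} p
  ...   | a , k , refl = a , k , x , refl

  module _ (β : Fin m → Bool) where

    act-combine : ∀ a k b k′ x → Voltage.act (kleinVoltage β) (combine a k) (combine b k′) x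
                               ≡ kleinAct (β k) (voltage a b) x
    act-combine a k b k′ x =
      cong₂ (λ (p q : Fin n × Fin m) → kleinAct (β (proj₂ p)) (voltage (proj₁ p) (proj₁ q)) x)
             (remQuot-combine a k) (remQuot-combine b k′)

    adj-vertex⁻ : ∀ a k x b k′ y → adj (graph β) (vertex a k x) (vertex b k′ y) ≡ true →
                  a ≢ b × k ≡ k′ × kleinAct (β k) (voltage a b) x ≡ y
    adj-vertex⁻ a k x b k′ y e
      with pq , xy ← liftAdj⁻ base (kleinVoltage β) (combine a k) x (combine b k′) y
             (trans (sym (lift-combine base (kleinVoltage β) (combine a k) x (combine b k′) y)) e)
      with ab , kk′ ← liftAdj⁻ (complete n) trivial a k b k′ (trans (sym (lift-combine (complete n) trivial a k b k′)) pq)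
      = complete-adj⁻ a b ab , kk′ , trans (sym (act-combine a k b k′ x)) xy

    adj-vertex⁺ : ∀ a k x b y → a ≢ b → kleinAct (β k) (voltage a b) x ≡ y →
                  adj (graph β) (vertex a k x) (vertex b k y) ≡ true
    adj-vertex⁺ a k x b y a≢b xy = trans
      (lift-combine base (kleinVoltage β) (combine a k) x (combine b k) y)
      (liftAdj⁺ base (kleinVoltage β) (combine a k) x (combine b k) y
        (trans (lift-combine (complete n) trivial a k b k)
               (liftAdj⁺ (complete n) trivial a k b k (complete-adj⁺ a≢b) refl))
        (trans (act-combine a k b k x) xy))

    -- Over `b` and over `c` the vertex has one neighbour each. Adjacency of these two means that
    -- the walks a-b-c and a-c carry `x` to the same point.
    simplicial⇒flat : ∀ a k x → Simplicial (graph β) (vertex a k x) → ∀ b c → a ≢ b → a ≢ c → b ≢ c →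
      kleinAct (β k) (voltage b c) (kleinAct (β k) (voltage a b) x) ≡ kleinAct (β k) (voltage a c) x
    simplicial⇒flat a k x simp b c a≢b a≢c b≢c = proj₂ (proj₂ (adj-vertex⁻ b k y c k z
      (simp (vertex b k y) (vertex c k z) (adj-vertex⁺ a k x b y a≢b refl) (adj-vertex⁺ a k x c z a≢c refl)
        λ e → b≢c (combine-injectiveˡ b k c k (combine-injectiveˡ (combine b k) y (combine c k) z e)))))
      where
      y = kleinAct (β k) (voltage a b) x
      z = kleinAct (β k) (voltage a c) x

    -- Every vertex of the base lies in a triangle with net voltage s and in one with net voltage t.
    simplicial⇒fixed : ∀ a k x → Simplicial (graph β) (vertex a k x) → Fixed (β k) x
    simplicial⇒fixed a k x simp 0F = refl
    simplicial⇒fixed 0F k x simp 1F = sym (simplicial⇒flat 0F k x simp 2F 1F (λ ()) (λ ()) (λ ()))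
    simplicial⇒fixed 1F k x simp 1F = sym (simplicial⇒flat 1F k x simp 2F 0F (λ ()) (λ ()) (λ ()))
    simplicial⇒fixed 2F k x simp 1F = simplicial⇒flat 2F k x simp 0F 1F (λ ()) (λ ()) (λ ())
    simplicial⇒fixed 3F k x simp 1F = simplicial⇒flat 3F k x simp 0F 1F (λ ()) (λ ()) (λ ())
    simplicial⇒fixed (suc (suc (suc (suc a)))) k x simp 1F = simplicial⇒flat (suc (suc (suc (suc a)))) k x simp 0F 1F (λ ()) (λ ()) (λ ())
    simplicial⇒fixed 2F k x simp 2F = sym (simplicial⇒flat 2F k x simp 0F 3F (λ ()) (λ ()) (λ ()))
    simplicial⇒fixed 3F k x simp 2F = sym (simplicial⇒flat 3F k x simp 0F 2F (λ ()) (λ ()) (λ ()))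
    simplicial⇒fixed 0F k x simp 2F = simplicial⇒flat 0F k x simp 2F 3F (λ ()) (λ ()) (λ ())
    simplicial⇒fixed 1F k x simp 2F = simplicial⇒flat 1F k x simp 2F 3F (λ ()) (λ ()) (λ ())
    simplicial⇒fixed (suc (suc (suc (suc a)))) k x simp 2F = simplicial⇒flat (suc (suc (suc (suc a)))) k x simp 2F 3F (λ ()) (λ ()) (λ ())

    -- Transport along any edge leaves a fixed point unchanged, so every triangle of the base closes
    -- up at `x`.
    fixed⇒simplicial : ∀ a k x → Fixed (β k) x → Simplicial (graph β) (vertex a k x)
    fixed⇒simplicial a k x fixed v w av aw v≢w
      with b , k₁ , y , refl ← vertex-surjective v
      with c , k₂ , z , refl ← vertex-surjective w
      with a≢b , refl , refl ← adj-vertex⁻ a k x b k₁ y av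
      with a≢c , refl , refl ← adj-vertex⁻ a k x c k₂ z aw
      = adj-vertex⁺ b k (kleinAct (β k) (voltage a b) x) c (kleinAct (β k) (voltage a c) x) b≢c y↦z
      where
      y↦z : kleinAct (β k) (voltage b c) (kleinAct (β k) (voltage a b) x) ≡ kleinAct (β k) (voltage a c) x
      y↦z = trans (cong (kleinAct (β k) (voltage b c)) (fixed (voltage a b)))
                  (trans (fixed (voltage b c)) (sym (fixed (voltage a c))))
      b≢c : b ≢ c
      -- Two neighbours over the same base vertex coincide, both being the transport of `x`.
      b≢c refl = v≢w refl

    simplicialCount-graph : simplicialCount (graph β) ≡ n ℕ.* (sumℕ λ k → if β k then 2 else 0)
    simplicialCount-graph = begin
      simplicialCount (graph β)
        ≡⟨ sumℕ-combine (n ℕ.* m) 6 (λ v → indicator (does (simplicial? (graph β) v))) ⟩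
      sumℕ {n ℕ.* m} (λ p → sumℕ {6} λ x → indicator (does (simplicial? (graph β) (combine p x))))
        ≡⟨ sumℕ-combine n m (λ p → sumℕ {6} λ x → indicator (does (simplicial? (graph β) (combine p x)))) ⟩
      sumℕ {n} (λ a → sumℕ {m} λ k → sumℕ {6} λ x → indicator (does (simplicial? (graph β) (vertex a k x))))
        ≡⟨ sumℕ-cong (λ a → sumℕ-cong λ k → trans
             (sumℕ-cong λ x → cong indicator (does-⇔ (mk⇔ (simplicial⇒fixed a k x) (fixed⇒simplicial a k x))
                                                     (simplicial? (graph β) (vertex a k x)) (fixed? (β k) x)))
             (fixedCount (β k))) ⟩
      sumℕ {n} (λ _ → sumℕ {m} λ k → if β k then 2 else 0)
        ≡⟨ sumℕ-const n (sumℕ λ k → if β k then 2 else 0) ⟩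
      n ℕ.* (sumℕ λ k → if β k then 2 else 0) ∎
      where
      -- The fixed points are the two trivial points of V ⊔ 1 ⊔ 1; each coset in the other V-set is
      -- moved by s or by t.
      fixedCount : ∀ b → sumℕ (λ x → indicator (does (fixed? b x))) ≡ (if b then 2 else 0)
      fixedCount true  = refl
      fixedCount false = refl

  first : ℕ → Fin m → Bool
  first i k = toℕ k <ᵇ i

  member : Fin m → Graph (n ℕ.* m ℕ.* 6)
  member i = graph (first (toℕ i))

  member-isospectral : ∀ i j → Isospectral (member i) (member j)
  member-isospectral i j k =
    trans (graph-isospectral (first (toℕ i)) k) (sym (graph-isospectral (first (toℕ j)) k))

  member-injective : ∀ i j → Isomorphic (member i) (member j) → i ≡ j
  member-injective i j iso = toℕ-injective (ℕ.*-cancelʳ-≡ (toℕ i) (toℕ j) 2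
    (trans (sym (prefix-sum m (toℕ i) (ℕ.<⇒≤ (toℕ<n i))))
    (trans (ℕ.*-cancelˡ-≡ (weight (toℕ i)) (weight (toℕ j)) n (trans (sym (simplicialCount-graph (first (toℕ i))))
                               (trans (simplicialCount-iso (member i) (member j) iso)
                                      (simplicialCount-graph (first (toℕ j))))))
           (prefix-sum m (toℕ j) (ℕ.<⇒≤ (toℕ<n j))))))
    where
    weight : ℕ → ℕ
    weight i = sumℕ {m} λ k → if first i k then 2 else 0
    -- The bound `i ≤ m` guarantees that the prefix of length `i` is not cut off at `m`.
    prefix-sum : ∀ m i → i ℕ.≤ m → sumℕ {m} (λ k → if toℕ k <ᵇ i then 2 else 0) ≡ i ℕ.* 2
    prefix-sum m       zero    _           = trans (sumℕ-const m 0) (ℕ.*-zeroʳ m)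
    prefix-sum (suc m) (suc i) (ℕ.s≤s i≤m) = cong (2 ℕ.+_) (prefix-sum m i i≤m)

-- Both prescribed degrees exceed 2.

primePower⇒1<q : ∀ {q} → PrimePower q → 1 ℕ.< q
primePower⇒1<q (p , k , p-prime , refl) = ℕ.<-≤-trans 1<p (ℕ.m≤m*n p (p ℕ.^ k))
  where
  1<p : 1 ℕ.< p
  1<p = ℕ.nonTrivial⇒n>1 p {{prime⇒nonTrivial p-prime}}
  instance
    p^k≢0 : ℕ.NonZero (p ℕ.^ k)
    p^k≢0 = ℕ.m^n≢0 p k {{ℕ.>-nonZero (ℕ.<-trans ℕ.z<s 1<p)}}

-- The quotient defining `r` is given with its denominator cleared. If `r ≤ 2`, the left side is at
-- most `2 * (q - 1)`, which is smaller than the right side because `q < q ^ d`.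
2<degree₁ : ∀ {d q r} → 3 ℕ.≤ d → 1 ℕ.< q → r ℕ.* (q ℕ.∸ 1) ≡ 2 ℕ.* (q ℕ.^ d ℕ.∸ 1) → 2 ℕ.< r
2<degree₁ {d} {q} {r} 3≤d 1<q e = ℕ.≰⇒> λ r≤2 → ℕ.<-irrefl e (ℕ.≤-<-trans
  (ℕ.*-monoˡ-≤ (q ℕ.∸ 1) r≤2)
  (ℕ.*-monoʳ-< 2 (ℕ.∸-monoˡ-< q<q^d (ℕ.<⇒≤ 1<q))))
  where
  q<q^d : q ℕ.< q ℕ.^ d
  q<q^d = subst (ℕ._< q ℕ.^ d) (ℕ.*-identityʳ q) (ℕ.^-monoʳ-< q 1<q (ℕ.≤-trans (ℕ.n≤1+n 2) 3≤d))

-- Already the first summand suffices: by the Pascal recurrence `gauss q d 1` is 1 plus `q` times a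
-- positive number, hence at least `1 + 2 * 1`.
2<degree₂ : ∀ {d q} → 3 ℕ.≤ d → 1 ℕ.< q → 2 ℕ.< gaussMiddleSum q d
2<degree₂ {suc (suc (suc d))} {q} (ℕ.s≤s (ℕ.s≤s (ℕ.s≤s _))) 1<q = ℕ.≤-trans
  (ℕ.s≤s (ℕ.*-mono-≤ {2} {q ℕ.^ 1} {1} (ℕ.≤-trans 1<q (ℕ.≤-reflexive (sym (ℕ.*-identityʳ q)))) (ℕ.s≤s ℕ.z≤n)))
  (ℕ.m≤m+n _ _)

theorem2 : (d q r : ℕ) → 3 ℕ.≤ d → PrimePower q →
    (r ℕ.* (q ℕ.∸ 1) ≡ 2 ℕ.* (q ℕ.^ d ℕ.∸ 1) ⊎ r ≡ gaussMiddleSum q d) →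
    (m : ℕ) → Σ (Fin m → ℕ) λ size → Σ ((i : Fin m) → Graph (size i)) λ G →
    ((i : Fin m) → Regular r (G i)) ×
    ((i j : Fin m) → i ≢ j → Isospectral (G i) (G j) × ¬ Isomorphic (G i) (G j))
theorem2 d q r 3≤d primePower degree m = family r 2<r
  where
  1<q : 1 ℕ.< q
  1<q = primePower⇒1<q primePower
  2<degree : r ℕ.* (q ℕ.∸ 1) ≡ 2 ℕ.* (q ℕ.^ d ℕ.∸ 1) ⊎ r ≡ gaussMiddleSum q d → 2 ℕ.< r
  2<degree (inj₁ e) = 2<degree₁ 3≤d 1<q e
  2<degree (inj₂ e) = subst (2 ℕ.<_) (sym e) (2<degree₂ 3≤d 1<q)
  2<r = 2<degree degree
  family : ∀ r → 2 ℕ.< r → Σ (Fin m → ℕ) λ size → Σ ((i : Fin m) → Graph (size i)) λ G →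
    ((i : Fin m) → Regular r (G i)) ×
    ((i j : Fin m) → i ≢ j → Isospectral (G i) (G j) × ¬ Isomorphic (G i) (G j))
  family (suc (suc (suc l))) (ℕ.s≤s (ℕ.s≤s (ℕ.s≤s _))) =
    (λ _ → n ℕ.* m ℕ.* 6) , member , (λ i → graph-regular (first (toℕ i))) ,
    λ i j i≢j → member-isospectral i j , i≢j ∘ member-injective i j
    where open Family l m
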